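{- Suppose that every choice function $C_v$, $v\in V$, satisfies the gapless condition (C). Let $\mathcal T=(x^1,\dots,x^N)$ be a non-excessive route. Then (i) any rotation occurs in $\mathcal T$ at most once; and (ii) $N<4|E|^2|F||W|$.
   Context: Model. $G=(V,E)$ is a finite bipartite graph without multiple edges with color classes $W$ and $F$; an edge joining $w\in W$, $f\in F$ is written $wf$. Capacities $b\in\mathbb Z_+^E$. For $v\in V$, $E_v$ is the set of edges at $v$, $\mathcal B_v=\{z\in\mathbb Z_+^{E_v}:z\le b|_{E_v}\}$, $\mathcal B=\{x\in\mathbb Z_+^E:x\le b\}$, $x_v$ the restriction of $x$ to $E_v$. Vector inequalities componentwise, $\wedge,\vee$ componentwise min/max, $|z|=\sum_e|z(e)|$, $\mathbf 1^e$ unit vector of $e$. Each $v$ has a choice function $C_v:\mathcal B_v\to\mathcal B_v$, $C_v(z)\le z$, with: (A1) $z\ge z'\ge C_v(z)\Rightarrow C_v(z')=C_v(z)$; (A2) $z\ge z'\Rightarrow C_v(z)\wedge z'\le C_v(z')$; (A3) $z\ge z'\Rightarrow|C_v(z)|\ge|C_v(z')|$. $z$ is acceptable if $C_v(z)=z$; for distinct acceptable $z,z'$, $z'\prec_v z$ iff $C_v(z\vee z')=z$. $e\in E_v$ is interesting for $v$ under acceptable $z$ if some $z'\in\mathcal B_v$ agrees with $z$ off $e$, has $z'(e)>z(e)$ and $C_v(z')(e)>z(e)$. A g-matching is $x\in\mathcal B$ with all $x_v$ acceptable; $wf$ blocks $x$ if interesting for $w$ under $x_w$ and for $f$ under $x_f$;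 stable = no blocking edge; $\mathcal S$ = stable g-matchings. Gapless condition (C) for $C_v$: if acceptable $z^1,z^2,z^3\in\mathcal B_v$ and edges $a,c^1,c^2,c^3\in E_v$ satisfy (i) $z^1\prec_v z^2\prec_v z^3$, (ii) $C_v(z^i+\mathbf 1^a)=z^i+\mathbf 1^a-\mathbf 1^{c^i}$ for $i=1,2,3$, and (iii) $c^1=c^3$, then $c^1=c^2$. Rotations. For $x\in\mathcal S$: $U_F^+(x)$ = edges $wf$ interesting for $f$ under $x_f$; $U_F^-(x)$ = edges $wf$ with $x(wf)>0$ not interesting for $f$ under $x_f$. Legal $F$-pair at $f$: distinct $a,c\in E_f$, $a\in U_F^+(x)$, $C_f(x_f+\mathbf 1^a)=x_f+\mathbf 1^a-\mathbf 1^c$. Legal $W$-pair at $w$: $c,a\in E_w$, $c\in U_F^-(x)$, $a\in U_F^+(x)$, $x_w+\mathbf 1^a-\mathbf 1^c$ acceptable; essential if no $d\in(U_F^+(x)\cap E_w)\setminus\{a\}$ is interesting for $w$ under $x_w+\mathbf 1^a-\mathbf 1^c$. A rotation applicable to $x$ is a cyclic sequence $R=(a_1,c_1,\dots,a_k,c_k)$ of pairwise distinct edges with $(a_i,c_i)$ legal $F$-pairs and $(c_i,a_{i+1})$ essential $W$-pairs (indices mod $k$); $\chi^R$ is $1$ on the $a_i$, $-1$ on the $c_i$, $0$ elsewhere; $\mathcal R(x)$ is the set of them. For $R\in\mathcal R(x)$, $\lambda\ge1$ is feasible if $x+i\chi^R\in\mathcal S$ for $0\le i\le\lambda$ and $R\in\mathcal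 R(x+i\chi^R)$ for $0\le i<\lambda$; $\tau_R(x)$ is the maximal feasible weight. A route is a sequence of stable g-matchings in which each member is obtained from the previous one $x'$ by adding $\lambda\chi^R$ with $R\in\mathcal R(x')$ and $\lambda$ feasible for $R$ under $x'$; it is non-excessive if whenever the same rotation $R$ is used at two steps, at the earlier step (applied to $x'$) its weight equals $\tau_R(x')$.
   Formalization: The graph is assumed to have at least one edge (|E| ≥ 1), because for E = ∅ the one-element route has N = 1 while 4|E|²|F||W| = 0, so (ii) would fail. -}

module Defs where

open import Data.Nat using (ℕ; zero; suc; _+_; _*_; _∸_; _≤_; _<_; _⊓_; _⊔_)
import Data.Fin
open import Data.Fin using (Fin; toℕ; inject₁) renaming (_≟_ to _≟ᶠ_)
open import Data.Vec using (Vec; lookup; tabulate; zipWith; sum)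
open import Data.List using (List; []; _∷_; _++_; [_]; zip; concatMap; filter; length)
open import Data.List.Relation.Unary.All using (All)
open import Data.List.Relation.Unary.Unique.Propositional using (Unique)
open import Data.Product using (Σ; ∃; ∃-syntax; _×_; _,_; proj₁; proj₂)
open import Data.Sum using (_⊎_; inj₁; inj₂)
open import Data.Bool using (if_then_else_)
open import Relation.Nullary using (¬_; Dec; yes; no)
open import Relation.Nullary.Decidable using (⌊_⌋)
open import Relation.Binary.PropositionalEquality using (_≡_; _≢_)

-- Bipartite graph with capacities.
-- Edges are Fin m, W = Fin p, F = Fin q.  Edge e joins wEnd e ∈ W and
-- fEnd e ∈ F; 'simple' says there are no multiple edges.
-- Vectors indexed by E (elements of ℤ₊^E) are  Vec ℕ m.
-- A vector in ℤ₊^{E_v} is represented as a vector in ℤ₊^E which is zero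
-- outside E_v.

Vertex : ℕ → ℕ → Set
Vertex p q = Fin p ⊎ Fin q

record Graph : Set where
  field
    m p q  : ℕ
    wEnd   : Fin m → Fin p
    fEnd   : Fin m → Fin q
    simple : ∀ e e' → wEnd e ≡ wEnd e' → fEnd e ≡ fEnd e' → e ≡ e'
    b      : Vec ℕ m

module _ (G : Graph) where
  open Graph G

  Incident : Fin m → Vertex p q → Set
  Incident e (inj₁ w) = wEnd e ≡ w
  Incident e (inj₂ f) = fEnd e ≡ f

  incident? : (e : Fin m) (v : Vertex p q) → Dec (Incident e v)
  incident? e (inj₁ w) = wEnd e ≟ᶠ w
  incident? e (inj₂ f) = fEnd e ≟ᶠ f

  _≤ᵥ_ : Vec ℕ m → Vec ℕ m → Set
  z ≤ᵥ z' = ∀ e → lookup z e ≤ lookup z' e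

  InB : Vertex p q → Vec ℕ m → Set
  InB v z = (z ≤ᵥ b) × (∀ e → ¬ Incident e v → lookup z e ≡ 0)

  record ChoiceAxioms (v : Vertex p q) (C : Vec ℕ m → Vec ℕ m) : Set where
    field
      closed : ∀ z → InB v z → InB v (C z)
      sub    : ∀ z → InB v z → C z ≤ᵥ z
      A1 : ∀ z z' → InB v z → InB v z' → z' ≤ᵥ z → C z ≤ᵥ z' → C z' ≡ C z
      A2 : ∀ z z' → InB v z → InB v z' → z' ≤ᵥ z → zipWith _⊓_ (C z) z' ≤ᵥ C z'
      A3 : ∀ z z' → InB v z → InB v z' → z' ≤ᵥ z → sum (C z') ≤ sum (C z)

record Market : Set where
  field
    graph  : Graph
  open Graph graph public
  field
    C      : Vertex p q → Vec ℕ m → Vec ℕ m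
    axioms : ∀ v → ChoiceAxioms graph v (C v)

module _ (M : Market) where
  open Market M

  _≤ₘ_ : Vec ℕ m → Vec ℕ m → Set
  _≤ₘ_ = _≤ᵥ_ graph

  𝟙 : Fin m → Vec ℕ m
  𝟙 e = tabulate (λ e' → if ⌊ e' ≟ᶠ e ⌋ then 1 else 0)

  _+ᵥ_ : Vec ℕ m → Vec ℕ m → Vec ℕ m
  _+ᵥ_ = zipWith _+_

  _∸ᵥ_ : Vec ℕ m → Vec ℕ m → Vec ℕ m
  _∸ᵥ_ = zipWith _∸_

  _∨ᵥ_ : Vec ℕ m → Vec ℕ m → Vec ℕ m
  _∨ᵥ_ = zipWith _⊔_

  Acceptable : Vertex p q → Vec ℕ m → Set
  Acceptable v z = InB graph v z × C v z ≡ z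

  Prec : Vertex p q → Vec ℕ m → Vec ℕ m → Set
  Prec v z z' = Acceptable v z × Acceptable v z' × z ≢ z' × C v (z' ∨ᵥ z) ≡ z'

  Interesting : Vertex p q → Vec ℕ m → Fin m → Set
  Interesting v z e =
    Incident graph e v ×
    ∃[ z' ] (InB graph v z' ×
             (∀ e' → e' ≢ e → lookup z' e' ≡ lookup z e') ×
             lookup z e < lookup z' e ×
             lookup z e < lookup (C v z') e)

  restrict : Vertex p q → Vec ℕ m → Vec ℕ m
  restrict v x = tabulate (λ e → if ⌊ incident? graph e v ⌋ then lookup x e else 0)

  wv fv : Fin m → Vertex p q
  wv e = inj₁ (wEnd e)
  fv e = inj₂ (fEnd e)

  GMatching : Vec ℕ m → Set
  GMatching x = (x ≤ₘ b) × (∀ v → Acceptable v (restrict v x))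

  Blocks : Vec ℕ m → Fin m → Set
  Blocks x e = Interesting (wv e) (restrict (wv e) x) e ×
               Interesting (fv e) (restrict (fv e) x) e

  Stable : Vec ℕ m → Set
  Stable x = GMatching x × (∀ e → ¬ Blocks x e)

  Gapless : Vertex p q → Set
  Gapless v = ∀ (z¹ z² z³ : Vec ℕ m) (a c¹ c² c³ : Fin m) →
    Incident graph a v → Incident graph c¹ v → Incident graph c² v → Incident graph c³ v →
    Acceptable v z¹ → Acceptable v z² → Acceptable v z³ →
    Prec v z¹ z² → Prec v z² z³ →
    InB graph v (z¹ +ᵥ 𝟙 a) → InB graph v (z² +ᵥ 𝟙 a) → InB graph v (z³ +ᵥ 𝟙 a) →
    -- C_v(z^i + 1^a) = z^i + 1^a - 1^{c^i}, written without subtraction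
    C v (z¹ +ᵥ 𝟙 a) +ᵥ 𝟙 c¹ ≡ z¹ +ᵥ 𝟙 a →
    C v (z² +ᵥ 𝟙 a) +ᵥ 𝟙 c² ≡ z² +ᵥ 𝟙 a →
    C v (z³ +ᵥ 𝟙 a) +ᵥ 𝟙 c³ ≡ z³ +ᵥ 𝟙 a →
    c¹ ≡ c³ → c¹ ≡ c²

  UFplus : Vec ℕ m → Fin m → Set
  UFplus x e = Interesting (fv e) (restrict (fv e) x) e

  UFminus : Vec ℕ m → Fin m → Set
  UFminus x e = 0 < lookup x e × ¬ UFplus x e

  LegalF : Vec ℕ m → Fin m → Fin m → Set
  LegalF x a c =
    a ≢ c × fEnd c ≡ fEnd a × UFplus x a ×
    C (fv a) (restrict (fv a) x +ᵥ 𝟙 a) +ᵥ 𝟙 c ≡ restrict (fv a) x +ᵥ 𝟙 a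

  -- x_w + 1^a - 1^c  (w = wEnd c); exact since x(c) > 0 for c ∈ U_F^-(x)
  wMove : Vec ℕ m → Fin m → Fin m → Vec ℕ m
  wMove x c a = (restrict (wv c) x +ᵥ 𝟙 a) ∸ᵥ 𝟙 c

  LegalW : Vec ℕ m → Fin m → Fin m → Set
  LegalW x c a = wEnd a ≡ wEnd c × UFminus x c × UFplus x a ×
                 Acceptable (wv c) (wMove x c a)

  EssentialW : Vec ℕ m → Fin m → Fin m → Set
  EssentialW x c a = LegalW x c a ×
    (∀ d → wEnd d ≡ wEnd c → UFplus x d → d ≢ a →
       ¬ Interesting (wv c) (wMove x c a) d)

  -- a rotation (a₁,c₁,…,a_k,c_k) is the list of pairs (aᵢ,cᵢ),
  -- read cyclically
  Rotation : Set
  Rotation = List (Fin m × Fin m)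

  rotate1 : ∀ {A : Set} → List A → List A
  rotate1 []       = []
  rotate1 (x ∷ xs) = xs ++ [ x ]

  flatten : Rotation → List (Fin m)
  flatten = concatMap (λ ac → proj₁ ac ∷ proj₂ ac ∷ [])

  Applicable : Vec ℕ m → Rotation → Set
  Applicable x R =
    R ≢ [] × Unique (flatten R) ×
    All (λ ac → LegalF x (proj₁ ac) (proj₂ ac)) R ×
    All (λ pp → EssentialW x (proj₂ (proj₁ pp)) (proj₁ (proj₂ pp))) (zip R (rotate1 R))

  SameRotation : Rotation → Rotation → Set
  SameRotation R R' = ∃[ l₁ ] ∃[ l₂ ] (R ≡ l₁ ++ l₂ × R' ≡ l₂ ++ l₁)

  -- number of i with aᵢ = e (resp. cᵢ = e); χ^R = chiPlus − chiMinus
  chiPlus chiMinus : Rotation → Fin m → ℕ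
  chiPlus  R e = length (filter (λ ac → proj₁ ac ≟ᶠ e) R)
  chiMinus R e = length (filter (λ ac → proj₂ ac ≟ᶠ e) R)

  -- y = x + λ χ^R  (as integer vectors)
  Shift : Vec ℕ m → ℕ → Rotation → Vec ℕ m → Set
  Shift x λ' R y = ∀ e → lookup y e + λ' * chiMinus R e ≡ lookup x e + λ' * chiPlus R e

  Feasible : Vec ℕ m → Rotation → ℕ → Set
  Feasible x R λ' =
    1 ≤ λ' ×
    (∀ i → i ≤ λ' → ∃[ y ] (Shift x i R y × Stable y)) ×
    (∀ i → i < λ' → ∃[ y ] (Shift x i R y × Applicable y R))

  IsTau : Vec ℕ m → Rotation → ℕ → Set
  IsTau x R λ' = Feasible x R λ' × (∀ μ → Feasible x R μ → μ ≤ λ')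

  -- a route (x¹,…,x^N) with N = suc n, together with the rotation
  -- rot j and weight wt j used at step j (from xs j to xs (j+1))
  record Route : Set where
    field
      n     : ℕ
      xs    : Fin (suc n) → Vec ℕ m
      rot   : Fin n → Rotation
      wt    : Fin n → ℕ
      stab  : ∀ i → Stable (xs i)
      appl  : ∀ j → Applicable (xs (inject₁ j)) (rot j)
      feas  : ∀ j → Feasible (xs (inject₁ j)) (rot j) (wt j)
      step  : ∀ j → Shift (xs (inject₁ j)) (wt j) (rot j) (xs (Data.Fin.suc j))

  NonExcessive : Route → Set
  NonExcessive T = ∀ j j' → toℕ j < toℕ j' → SameRotation (rot j) (rot j') →
                   IsTau (xs (inject₁ j)) (rot j) (wt j)
    where open Route T

module Submission where

-- Call the legal F-pairs and the essential W-pairs at x the arcs at x. The pair (c , a) is essential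
-- exactly when C_w, offered at every edge of U_F^+(x) the full capacity and one unit less at c, picks
-- x_w + 1^a - 1^c. In this form (C), applied at f to the F-pairs and at w to the W-pairs (with c in
-- the role of the added edge), shows that an arc present at two members of a route is present at all
-- members in between. Substitutability and size monotonicity make x + χ^R stable for every R
-- applicable to x, so a rotation used twice, being still applicable right after its first use, could
-- have been given a larger weight there. Finally, at the first time when all arcs of R are present,
-- one of them has never been present before; since each arc has a unique successor, that arc
-- determines the time and then R. There are at most 2|E|² arcs.

open import Defs
open import Data.Bool using (if_then_else_)
open import Data.Fin using (Fin; zero; suc; toℕ; fromℕ<; inject₁; join; splitAt; combine)
  renaming (_≟_ to _≟ᶠ_)
open import Data.Fin.Properties
  using (¬∀⟶∃¬; toℕ-inject₁; toℕ-injective; splitAt-join; combine-injective; injective⇒≤; nonZeroIndex)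
open import Data.List using (List; []; _∷_; _++_; [_]; map; zip; length; filter)
open import Data.List.Membership.DecPropositional using (_∈?_)
open import Data.List.Membership.Propositional using (_∈_; _∉_; find)
open import Data.List.Membership.Propositional.Properties
  using (∈-map⁺; ∈-map⁻; ∈-++⁺ˡ; ∈-++⁺ʳ; ∈-++⁻; ∈-∃++)
open import Data.List.Properties using (map-++; map-∘; ++-assoc; ++-identityʳ; length-++; ∷-injective)
open import Data.List.Relation.Binary.Permutation.Propositional using (↭⇒↭ₛ)
open import Data.List.Relation.Binary.Permutation.Propositional.Properties
  using () renaming (map⁺ to ↭-map⁺; ++-comm to ↭-++-comm)
open import Data.List.Relation.Binary.Permutation.Setoid.Properties using (Unique-resp-↭)
open import Data.List.Relation.Unary.All using (All; []; _∷_)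
  renaming (lookup to All-lookup; map to All-map; zipWith to All-zipWith; all? to All-all?)
open import Data.List.Relation.Unary.All.Properties using (All¬⇒¬Any; ¬All⇒Any¬; ¬Any⇒All¬)
  renaming (map⁺ to All-map⁺; map⁻ to All-map⁻; ++⁺ to All-++⁺; ++⁻ˡ to All-++⁻ˡ; ++⁻ʳ to All-++⁻ʳ)
open import Data.List.Relation.Unary.AllPairs using ([]; _∷_)
open import Data.List.Relation.Unary.Any using (here; there)
open import Data.List.Relation.Unary.Unique.Propositional using (Unique)
open import Data.Nat using (ℕ; zero; suc; _+_; _*_; _∸_; _≤_; _<_; _⊓_; _⊔_; z≤n; s≤s; s≤s⁻¹)
open import Data.Nat.Properties
open import Data.Nat.Tactic.RingSolver using (solve-∀)
open import Data.Product using (∃; ∃-syntax; _×_; _,_; proj₁; proj₂; uncurry)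
open import Data.Sum using (_⊎_; inj₁; inj₂) renaming (map to ⊎-map)
open import Data.Sum.Properties using (inj₁-injective; inj₂-injective)
open import Data.Vec using (Vec; []; _∷_; lookup; tabulate; zipWith; sum)
open import Data.Vec.Properties
  using (lookup∘tabulate; tabulate∘lookup; tabulate-cong; lookup-zipWith) renaming (≡-dec to vec-≟)
open import Function using (_∘_)
open import Relation.Binary using (tri<; tri≈; tri>)
open import Relation.Binary.PropositionalEquality
  using (_≡_; _≢_; refl; sym; trans; cong; cong₂; subst; setoid; module ≡-Reasoning)
open import Relation.Nullary using (¬_; Dec; yes; no; contradiction)
open import Relation.Nullary.Decidable using (⌊_⌋; _×-dec_; ¬?; map′)

-- Condition (C) only compares three exchanges that are already given, so convexity must first
-- produce an exchange at the middle member. This is a count: all members of a route have the same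
-- size at every vertex, and size monotonicity then leaves exactly one unit to be dropped. A second
-- obstacle is that a W-pair is not an exchange caused by offering `a`: w loses `c` and replaces it.
-- Read backwards it is one: when `c` is offered again to the reduced choice, w returns to its old
-- assignment and drops `a`. Along a route the choices of w get worse, so on this side (C) is
-- applied to the members in reverse order. For the count of steps, the member where a rotation is
-- used is of no help, since all its arcs may be old there. The first member at which they are all
-- present may serve several rotations, but rotations legal at the same member and sharing an edge
-- a_i coincide. Presence of an arc is made decidable because these first members have to be found
-- constructively.

private variable
  k : ℕ

-- Integer vectors: pointwise order, unit vectors, sums

infix  4 _≼_
infixl 6 _⊕_ _⊖_

-- A record, unlike the unfolding pointwise order _≤ᵥ_, lets Agda infer both vectors from a proof.
record _≼_ {k} (u v : Vec ℕ k) : Set where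
  constructor pointwise
  field at : ∀ i → lookup u i ≤ lookup v i
open _≼_

_⊕_ _⊖_ _⊔ᵥ_ : Vec ℕ k → Vec ℕ k → Vec ℕ k
_⊕_  = zipWith _+_
_⊖_  = zipWith _∸_
_⊔ᵥ_ = zipWith _⊔_

unit : Fin k → Vec ℕ k
unit e = tabulate λ i → if ⌊ i ≟ᶠ e ⌋ then 1 else 0

≼-refl : {u : Vec ℕ k} → u ≼ u
≼-refl .at i = ≤-refl

≼-trans : {u v w : Vec ℕ k} → u ≼ v → v ≼ w → u ≼ w
≼-trans p q .at i = ≤-trans (at p i) (at q i)

≼-reflexive : {u v : Vec ℕ k} → u ≡ v → u ≼ v
≼-reflexive refl = ≼-refl

lookup-ext : {u v : Vec ℕ k} → (∀ i → lookup u i ≡ lookup v i) → u ≡ v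
lookup-ext {u = u} {v} p =
  trans (sym (tabulate∘lookup u)) (trans (tabulate-cong p) (tabulate∘lookup v))

≼-antisym : {u v : Vec ℕ k} → u ≼ v → v ≼ u → u ≡ v
≼-antisym p q = lookup-ext λ i → ≤-antisym (at p i) (at q i)

⊕-at : ∀ (u v : Vec ℕ k) i → lookup (u ⊕ v) i ≡ lookup u i + lookup v i
⊕-at u v i = lookup-zipWith _+_ i u v

⊖-at : ∀ (u v : Vec ℕ k) i → lookup (u ⊖ v) i ≡ lookup u i ∸ lookup v i
⊖-at u v i = lookup-zipWith _∸_ i u v

⊔-at : ∀ (u v : Vec ℕ k) i → lookup (u ⊔ᵥ v) i ≡ lookup u i ⊔ lookup v i
⊔-at u v i = lookup-zipWith _⊔_ i u v

unit-self : (e : Fin k) → lookup (unit e) e ≡ 1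
unit-self e rewrite lookup∘tabulate (λ i → if ⌊ i ≟ᶠ e ⌋ then 1 else 0) e with e ≟ᶠ e
... | yes _ = refl
... | no ne = contradiction refl ne

unit-other : {e i : Fin k} → i ≢ e → lookup (unit e) i ≡ 0
unit-other {e = e} {i} ne rewrite lookup∘tabulate (λ i → if ⌊ i ≟ᶠ e ⌋ then 1 else 0) i with i ≟ᶠ e
... | yes p = contradiction p ne
... | no _  = refl

bump-self : ∀ (u : Vec ℕ k) e → lookup (u ⊕ unit e) e ≡ suc (lookup u e)
bump-self u e rewrite ⊕-at u (unit e) e | unit-self e = +-comm _ 1

bump-other : ∀ (u : Vec ℕ k) {e i} → i ≢ e → lookup (u ⊕ unit e) i ≡ lookup u i
bump-other u {e} {i} ne rewrite ⊕-at u (unit e) i | unit-other ne = +-identityʳ _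

drop-other : ∀ (u : Vec ℕ k) {e i} → i ≢ e → lookup (u ⊖ unit e) i ≡ lookup u i
drop-other u {e} {i} ne rewrite ⊖-at u (unit e) i | unit-other ne = refl

≼-⊕ : (u v : Vec ℕ k) → u ≼ u ⊕ v
≼-⊕ u v .at i rewrite ⊕-at u v i = m≤m+n _ _

⊖-≼ : (u v : Vec ℕ k) → u ⊖ v ≼ u
⊖-≼ u v .at i rewrite ⊖-at u v i = m∸n≤m _ (lookup v i)

≼-⊔ˡ : (u v : Vec ℕ k) → u ≼ u ⊔ᵥ v
≼-⊔ˡ u v .at i rewrite ⊔-at u v i = m≤m⊔n _ _

≼-⊔ʳ : (u v : Vec ℕ k) → v ≼ u ⊔ᵥ v
≼-⊔ʳ u v .at i rewrite ⊔-at u v i = m≤n⊔m (lookup u i) _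

⊔ᵥ-lub : {u v w : Vec ℕ k} → u ≼ w → v ≼ w → u ⊔ᵥ v ≼ w
⊔ᵥ-lub {u = u} {v} p q .at i rewrite ⊔-at u v i = ⊔-lub (at p i) (at q i)

⊕-monoˡ : {u v : Vec ℕ k} (w : Vec ℕ k) → u ≼ v → u ⊕ w ≼ v ⊕ w
⊕-monoˡ {u = u} {v} w p .at i rewrite ⊕-at u w i | ⊕-at v w i = +-monoˡ-≤ _ (at p i)

⊖-monoˡ : {u v : Vec ℕ k} (w : Vec ℕ k) → u ≼ v → u ⊖ w ≼ v ⊖ w
⊖-monoˡ {u = u} {v} w p .at i rewrite ⊖-at u w i | ⊖-at v w i = ∸-monoˡ-≤ (lookup w i) (at p i)

bump-≼ : {u v : Vec ℕ k} {e : Fin k} → u ≼ v → lookup u e < lookup v e → u ⊕ unit e ≼ v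
bump-≼ {u = u} {e = e} p lt .at i with i ≟ᶠ e
... | yes refl rewrite bump-self u e = lt
... | no ne rewrite bump-other u ne = at p i

⊕⊖-cancel : (u v : Vec ℕ k) → (u ⊕ v) ⊖ v ≡ u
⊕⊖-cancel u v = lookup-ext λ i →
  trans (⊖-at (u ⊕ v) v i) (trans (cong (_∸ lookup v i) (⊕-at u v i)) (m+n∸n≡m _ (lookup v i)))

⊖⊕-cancel : {u v : Vec ℕ k} → v ≼ u → (u ⊖ v) ⊕ v ≡ u
⊖⊕-cancel {u = u} {v} p = lookup-ext λ i →
  trans (⊕-at (u ⊖ v) v i) (trans (cong (_+ lookup v i) (⊖-at u v i)) (m∸n+n≡m (at p i)))

unit-≼ : {u : Vec ℕ k} {e : Fin k} → 0 < lookup u e → unit e ≼ u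
unit-≼ {e = e} pos .at i with i ≟ᶠ e
... | yes refl rewrite unit-self e = pos
... | no ne rewrite unit-other ne = z≤n

unit-injective : {u v : Vec ℕ k} {e e' : Fin k} → u ≡ v ⊕ unit e → u ≡ v ⊕ unit e' → e ≡ e'
unit-injective {v = v} {e} {e'} p q with e ≟ᶠ e'
... | yes eq = eq
... | no ne  = contradiction
  (trans (sym (bump-self v e)) (trans (cong (λ z → lookup z e) (trans (sym p) q)) (bump-other v ne))) 1+n≢n

sum-⊕ : (u v : Vec ℕ k) → sum (u ⊕ v) ≡ sum u + sum v
sum-⊕ []      []      = refl
sum-⊕ (x ∷ u) (y ∷ v) rewrite sum-⊕ u v = begin
  x + y + (sum u + sum v)   ≡⟨ +-assoc x y _ ⟩
  x + (y + (sum u + sum v)) ≡⟨ cong (x +_) (trans (sym (+-assoc y _ _)) (trans (cong (_+ sum v) (+-comm y _)) (+-assoc (sum u) y _))) ⟩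
  x + (sum u + (y + sum v)) ≡⟨ +-assoc x _ _ ⟨
  x + sum u + (y + sum v)   ∎
  where open ≡-Reasoning

sum-zero : sum (tabulate {n = k} λ _ → 0) ≡ 0
sum-zero {zero}  = refl
sum-zero {suc k} = sum-zero {k}

sum-unit : (e : Fin k) → sum (unit e) ≡ 1
sum-unit {suc k} zero    = cong suc (sum-zero {k})
sum-unit {suc k} (suc e) = trans (cong sum (tabulate-cong shift)) (sum-unit e)
  where
  shift : ∀ i → (if ⌊ suc i ≟ᶠ suc e ⌋ then 1 else 0) ≡ (if ⌊ i ≟ᶠ e ⌋ then 1 else 0)
  shift i with i ≟ᶠ e
  ... | yes _ = refl
  ... | no _  = refl

sum-bump : (u : Vec ℕ k) (e : Fin k) → sum (u ⊕ unit e) ≡ suc (sum u)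
sum-bump u e rewrite sum-⊕ u (unit e) | sum-unit e = +-comm _ 1

sum-mono : {u v : Vec ℕ k} → u ≼ v → sum u ≤ sum v
sum-mono {u = []}    {[]}    p = z≤n
sum-mono {u = x ∷ u} {y ∷ v} p =
  +-mono-≤ (at p zero) (sum-mono {u = u} {v} (pointwise (at p ∘ suc)))

≼∧sum≥⇒≡ : {u v : Vec ℕ k} → u ≼ v → sum v ≤ sum u → u ≡ v
≼∧sum≥⇒≡ {u = u} {v} p le = lookup-ext eq
  where
  eq : ∀ i → lookup u i ≡ lookup v i
  eq i with m≤n⇒m<n∨m≡n (at p i)
  ... | inj₂ same = same
  ... | inj₁ lt = contradiction
    (≤-trans (≤-reflexive (sym (sum-bump u i))) (≤-trans (sum-mono (bump-≼ p lt)) le)) 1+n≰n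

-- The source of every exchange at a middle member: the choice axioms yield only inclusions and
-- sizes, and this turns them into a single edge.
sum-gap-one : {u v : Vec ℕ k} → u ≼ v → sum v ≡ suc (sum u) → ∃[ e ] u ⊕ unit e ≡ v
sum-gap-one {k} {u} {v} p eq = e ,
  ≼∧sum≥⇒≡ (bump-≼ p (≤∧≢⇒< (at p e) (proj₂ differs)))
    (≤-reflexive (trans eq (sym (sum-bump u e))))
  where
  differs : ∃[ i ] lookup u i ≢ lookup v i
  differs = ¬∀⟶∃¬ k (λ i → lookup u i ≡ lookup v i) (λ i → lookup u i Data.Nat.≟ lookup v i)
    λ all → 1+n≢n (trans (sym eq) (cong sum (sym (lookup-ext {u = u} {v} all))))
  e = proj₁ differs

-- Multiplicity vectors of edge lists

count : List (Fin k) → Vec ℕ k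
count []      = tabulate λ _ → 0
count (e ∷ l) = unit e ⊕ count l

count-∉ : ∀ {e : Fin k} l → e ∉ l → lookup (count l) e ≡ 0
count-∉ {e = e} []      _  = lookup∘tabulate (λ _ → 0) e
count-∉ {e = e} (d ∷ l) e∉ = trans (⊕-at (unit d) (count l) e)
  (cong₂ _+_ (unit-other {e = d} {e} λ { refl → e∉ (here refl) }) (count-∉ l (e∉ ∘ there)))

count-∈ : ∀ {e : Fin k} {l} → Unique l → e ∈ l → lookup (count l) e ≡ 1
count-∈ {e = e} {d ∷ l} (d∉ ∷ _) (here refl) = trans (⊕-at (unit d) (count l) e)
  (cong₂ _+_ (unit-self d) (count-∉ l (All¬⇒¬Any d∉)))
count-∈ {e = e} {d ∷ l} (d∉ ∷ u) (there e∈) = trans (⊕-at (unit d) (count l) e)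
  (cong₂ _+_ (unit-other {e = d} {e} λ { refl → All¬⇒¬Any d∉ e∈ }) (count-∈ u e∈))

unit-≼-count : ∀ (l : List (Fin k)) {e} → e ∈ l → unit e ≼ count l
unit-≼-count (d ∷ l) (here refl) = ≼-⊕ (unit d) (count l)
unit-≼-count (d ∷ l) (there e∈) .at i = ≤-trans (at (unit-≼-count l e∈) i)
  (≤-trans (m≤n+m _ _) (≤-reflexive (sym (⊕-at (unit d) (count l) i))))

count-∷ʳ : ∀ (e : Fin k) l → count (l ++ [ e ]) ≡ count (e ∷ l)
count-∷ʳ e []      = refl
count-∷ʳ e (d ∷ l) = lookup-ext λ i → begin
  lookup (unit d ⊕ count (l ++ [ e ])) i                      ≡⟨ ⊕-at (unit d) _ i ⟩
  lookup (unit d) i + lookup (count (l ++ [ e ])) i           ≡⟨ cong (λ u → lookup (unit d) i + lookup u i) (count-∷ʳ e l) ⟩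
  lookup (unit d) i + lookup (unit e ⊕ count l) i             ≡⟨ cong (lookup (unit d) i +_) (⊕-at (unit e) (count l) i) ⟩
  lookup (unit d) i + (lookup (unit e) i + lookup (count l) i) ≡⟨ +-assoc (lookup (unit d) i) _ _ ⟨
  lookup (unit d) i + lookup (unit e) i + lookup (count l) i   ≡⟨ cong (_+ lookup (count l) i) (+-comm (lookup (unit d) i) _) ⟩
  lookup (unit e) i + lookup (unit d) i + lookup (count l) i   ≡⟨ +-assoc (lookup (unit e) i) _ _ ⟩
  lookup (unit e) i + (lookup (unit d) i + lookup (count l) i) ≡⟨ cong (lookup (unit e) i +_) (⊕-at (unit d) (count l) i) ⟨
  lookup (unit e) i + lookup (unit d ⊕ count l) i             ≡⟨ ⊕-at (unit e) _ i ⟨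
  lookup (unit e ⊕ (unit d ⊕ count l)) i                      ∎
  where open ≡-Reasoning

-- Links `chiPlus` and `chiMinus` to vectors, on which restriction to a vertex and summation can
-- act.
count-filter : ∀ {A : Set} (g : A → Fin k) l e →
               length (filter (λ r → g r ≟ᶠ e) l) ≡ lookup (count (map g l)) e
count-filter g []      e = sym (lookup∘tabulate (λ _ → 0) e)
count-filter g (r ∷ l) e with g r ≟ᶠ e
... | yes refl = trans (cong suc (count-filter g l e))
  (sym (trans (⊕-at (unit e) (count (map g l)) e) (cong (_+ lookup (count (map g l)) e) (unit-self e))))
... | no ne = trans (count-filter g l e)
  (sym (trans (⊕-at (unit (g r)) (count (map g l)) e)
    (cong (_+ lookup (count (map g l)) e) (unit-other (ne ∘ sym)))))

map-proj₁-zip : ∀ {A B : Set} (l : List A) (l' : List B) → length l ≡ length l' → map proj₁ (zip l l') ≡ l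
map-proj₁-zip []      []        _  = refl
map-proj₁-zip (x ∷ l) (_ ∷ l') eq = cong (x ∷_) (map-proj₁-zip l l' (suc-injective eq))

map-proj₂-zip : ∀ {A B : Set} (l : List A) (l' : List B) → length l ≡ length l' → map proj₂ (zip l l') ≡ l'
map-proj₂-zip []      []        _  = refl
map-proj₂-zip (_ ∷ l) (y ∷ l') eq = cong (y ∷_) (map-proj₂-zip l l' (suc-injective eq))

-- A single choice function: revealed preference, gains, exchanges

module Choice (M : Market) (v : Vertex (Market.p M) (Market.q M)) where
  open Market M using (m; b; graph)
  open ChoiceAxioms (Market.axioms M v)

  Cv : Vec ℕ m → Vec ℕ m
  Cv = Market.C M v

  record B (z : Vec ℕ m) : Set where
    constructor feasible
    field
      bound : z ≼ b
      off   : ∀ e → ¬ Incident graph e v → lookup z e ≡ 0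
  open B public

  B⇒InB : ∀ {z} → B z → InB graph v z
  B⇒InB Bz = at (bound Bz) , off Bz

  InB⇒B : ∀ {z} → InB graph v z → B z
  InB⇒B (le , o) = feasible (pointwise le) o

  Acc : Vec ℕ m → Set
  Acc z = B z × Cv z ≡ z

  Acc⇒Acceptable : ∀ {z} → Acc z → Acceptable M v z
  Acc⇒Acceptable (Bz , fix) = B⇒InB Bz , fix

  Acceptable⇒Acc : ∀ {z} → Acceptable M v z → Acc z
  Acceptable⇒Acc (Bz , fix) = InB⇒B Bz , fix

  C≼ : ∀ {z} → B z → Cv z ≼ z
  C≼ Bz = pointwise (sub _ (B⇒InB Bz))

  private variable
    z z' z₁ z₂ z₃ Z : Vec ℕ m
    a c e : Fin m

  B-down : B Z → z ≼ Z → B z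
  B-down BZ p = feasible (≼-trans p (bound BZ))
    λ e ni → n≤0⇒n≡0 (≤-trans (at p e) (≤-reflexive (off BZ e ni)))

  B-incident : B z → 0 < lookup z e → Incident graph e v
  B-incident {z} {e} Bz pos with incident? graph e v
  ... | yes i = i
  ... | no ni = contradiction (off Bz e ni) (m<n⇒n≢0 pos)

  C-between : B Z → z ≼ Z → Cv Z ≼ z → Cv z ≡ Cv Z
  C-between BZ p q = A1 _ _ (B⇒InB BZ) (B⇒InB (B-down BZ p)) (at p) (at q)

  -- Axiom (A2) at one coordinate. The threshold `k` replaces the minimum, so that a caller supplies
  -- two separate bounds.
  C-keep : B Z → z ≼ Z → ∀ e {k} → k ≤ lookup (Cv Z) e → k ≤ lookup z e → k ≤ lookup (Cv z) e
  C-keep {Z} {z} BZ p e k≤C k≤z = ≤-trans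
    (≤-trans (⊓-glb k≤C k≤z) (≤-reflexive (sym (lookup-zipWith _⊓_ e (Cv Z) z))))
    (A2 Z z (B⇒InB BZ) (B⇒InB (B-down BZ p)) (at p) e)

  C-size : B Z → z ≼ Z → sum (Cv z) ≤ sum (Cv Z)
  C-size BZ p = A3 _ _ (B⇒InB BZ) (B⇒InB (B-down BZ p)) (at p)

  C-acceptable : B Z → Acc (Cv Z)
  C-acceptable BZ = B-down BZ (C≼ BZ) , C-between BZ (C≼ BZ) ≼-refl

  infix 4 _⪯_
  -- The reflexive form of `Prec`; acceptability is carried separately.
  _⪯_ : Vec ℕ m → Vec ℕ m → Set
  z ⪯ z' = Cv (z' ⊔ᵥ z) ≡ z'

  -- The join of the choice with any part of the menu lies between the choice and the menu, so (A1)
  -- applies. All preferences used below arise in this way.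
  chosen-⪯ : B Z → Cv Z ≡ z' → z ≼ Z → z ⪯ z'
  chosen-⪯ {z' = z'} {z} BZ refl p =
    C-between BZ (⊔ᵥ-lub (C≼ BZ) p) (≼-⊔ˡ z' z)

  B-⊔ : B z → B z' → B (z ⊔ᵥ z')
  B-⊔ {z} {z'} Bz Bz' = feasible (⊔ᵥ-lub (bound Bz) (bound Bz'))
    λ e ni → trans (⊔-at z z' e) (cong₂ _⊔_ (off Bz e ni) (off Bz' e ni))

  ⪯-refl : Acc z → z ⪯ z
  ⪯-refl {z} (Bz , acc) = chosen-⪯ Bz acc ≼-refl

  -- Consider the choice from the join of all three. Where `z₁` is the largest, (A2) against
  -- `z₂ ⊔ᵥ z₁` bounds it by `z₂`; so it lies below `z₃ ⊔ᵥ z₂`, and (A1) makes it `z₃`.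
  ⪯-trans : B z₁ → B z₂ → B z₃ → z₁ ⪯ z₂ → z₂ ⪯ z₃ → z₁ ⪯ z₃
  ⪯-trans {z₁} {z₂} {z₃} B₁ B₂ B₃ p q =
    chosen-⪯ BZ (trans (sym (C-between BZ (≼-⊔ˡ (z₃ ⊔ᵥ z₂) z₁) below)) q) (≼-⊔ʳ (z₃ ⊔ᵥ z₂) z₁)
    where
    Z' = (z₃ ⊔ᵥ z₂) ⊔ᵥ z₁
    BZ : B Z'
    BZ = B-⊔ (B-⊔ B₃ B₂) B₁
    z₂₁≼Z : z₂ ⊔ᵥ z₁ ≼ Z'
    z₂₁≼Z = ⊔ᵥ-lub (≼-trans (≼-⊔ʳ z₃ z₂) (≼-⊔ˡ (z₃ ⊔ᵥ z₂) z₁)) (≼-⊔ʳ (z₃ ⊔ᵥ z₂) z₁)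
    below : Cv Z' ≼ z₃ ⊔ᵥ z₂
    below .at i with ≤-total (lookup z₁ i) (lookup (z₃ ⊔ᵥ z₂) i)
    ... | inj₁ le = ≤-trans (at (C≼ BZ) i)
      (≤-reflexive (trans (⊔-at (z₃ ⊔ᵥ z₂) z₁ i) (m≥n⇒m⊔n≡m le)))
    ... | inj₂ ge = ≤-trans
      (≤-trans
        (C-keep BZ z₂₁≼Z i ≤-refl (≤-trans (at (C≼ BZ) i)
          (≤-trans (≤-reflexive (trans (⊔-at (z₃ ⊔ᵥ z₂) z₁ i) (m≤n⇒m⊔n≡n ge))) (at (≼-⊔ʳ z₂ z₁) i))))
        (≤-reflexive (cong (λ u → lookup u i) p)))
      (at (≼-⊔ʳ z₃ z₂) i)

  Gain : Vec ℕ m → Fin m → Set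
  Gain z e = lookup z e < lookup b e × lookup z e < lookup (Cv (z ⊕ unit e)) e

  gain? : ∀ z e → Dec (Gain z e)
  gain? z e = (lookup z e <? lookup b e) ×-dec (lookup z e <? lookup (Cv (z ⊕ unit e)) e)

  B-bump : B z → Incident graph e v → lookup z e < lookup b e → B (z ⊕ unit e)
  B-bump {z} {e} Bz inc lt = feasible (bump-≼ (bound Bz) lt) off'
    where
    off' : ∀ e' → ¬ Incident graph e' v → lookup (z ⊕ unit e) e' ≡ 0
    off' e' ni = trans (bump-other z λ { refl → ni inc }) (off Bz e' ni)

  interesting⇒gain : B z → Interesting M v z e → Gain z e
  interesting⇒gain {z} {e} Bz (inc , Z , InBZ , agree , lt , lt') =
    <-≤-trans lt (at (bound BZ) e) ,
    C-keep BZ (bump-≼ z≼Z lt) e lt' (≤-reflexive (sym (bump-self z e)))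
    where
    BZ = InB⇒B InBZ
    z≼Z : z ≼ Z
    z≼Z .at i with i ≟ᶠ e
    ... | yes refl = <⇒≤ lt
    ... | no ne    = ≤-reflexive (sym (agree i ne))

  gain⇒interesting : B z → Incident graph e v → Gain z e → Interesting M v z e
  gain⇒interesting {z} {e} Bz inc (lt , lt') =
    inc , z ⊕ unit e , B⇒InB (B-bump Bz inc lt) , (λ e' ne → bump-other z ne) ,
    ≤-reflexive (sym (bump-self z e)) , lt'

  -- If `Z` kept more at `e`, then by (A2) so would `z` with one extra unit there, which is a gain.
  C≤-nongain : B Z → z ≼ Z → ¬ Gain z e → lookup (Cv Z) e ≤ lookup z e
  C≤-nongain {Z} {z} {e} BZ p ng with lookup (Cv Z) e ≤? lookup z e
  ... | yes le = le
  ... | no nle = contradiction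
    (<-≤-trans z<Z (at (bound BZ) e) ,
     C-keep BZ (bump-≼ p z<Z) e (≰⇒> nle) (≤-reflexive (sym (bump-self z e)))) ng
    where
    z<Z = <-≤-trans (≰⇒> nle) (at (C≼ BZ) e)

  -- The menu had a further unit of `e` and it was refused; by (A1) it is refused again when offered
  -- alone.
  chosen-nongain : B Z → Cv Z ≡ z → lookup z e < lookup Z e → ¬ Gain z e
  chosen-nongain {Z} {z} {e} BZ refl lt (_ , gain) = <-irrefl
    (cong (λ u → lookup u e) (sym (C-between BZ (bump-≼ (C≼ BZ) lt) (≼-⊕ z (unit e))))) gain

  -- By (A2) the extra unit cannot raise the choice from the join above `z'` off `e`, and at `e` the
  -- last hypothesis bounds it; (A1) finishes. The join is then a common menu above both `z` and
  -- `z'`, on which they can be compared.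
  C-bump-⊔ : B z → B z' → z ⪯ z' → Incident graph e v → lookup z' e < lookup b e →
             lookup z e ≤ lookup z' e →
             B ((z' ⊔ᵥ z) ⊕ unit e) × Cv ((z' ⊔ᵥ z) ⊕ unit e) ≡ Cv (z' ⊕ unit e)
  C-bump-⊔ {z} {z'} {e} Bz Bz' pref inc lt le =
    BZ , sym (C-between BZ (⊕-monoˡ (unit e) (≼-⊔ˡ z' z)) below)
    where
    J = z' ⊔ᵥ z
    Je : lookup J e ≡ lookup z' e
    Je = trans (⊔-at z' z e) (m≥n⇒m⊔n≡m le)
    BZ : B (J ⊕ unit e)
    BZ = B-bump (B-⊔ Bz' Bz) inc (≤-<-trans (≤-reflexive Je) lt)
    below : Cv (J ⊕ unit e) ≼ z' ⊕ unit e
    below .at i with i ≟ᶠ e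
    ... | yes refl = ≤-trans (at (C≼ BZ) e)
      (≤-reflexive (trans (bump-self J e) (trans (cong suc Je) (sym (bump-self z' e)))))
    ... | no ne = ≤-trans
      (≤-trans (C-keep BZ (≼-⊕ J (unit e)) i ≤-refl
                 (≤-trans (at (C≼ BZ) i) (≤-reflexive (bump-other J ne))))
               (≤-reflexive (cong (λ u → lookup u i) pref)))
      (at (≼-⊕ z' (unit e)) i)

  gain-≤ : B z → B z' → z ⪯ z' → Gain z' e → lookup z e ≤ lookup z' e
  gain-≤ {z} {z'} {e} Bz Bz' pref g with lookup z e ≤? lookup z' e
  ... | yes le = le
  ... | no nle = contradiction g
    (chosen-nongain (B-⊔ Bz' Bz) pref (<-≤-trans (≰⇒> nle) (at (≼-⊔ʳ z' z) e)))

  -- Without a gain at `z`, every menu above `z` keeps at most `z(e)`, hence at most `z'(e)`; the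
  -- join with one more unit is such a menu, yet its choice is that of `z' ⊕ unit e`.
  gain-anti : B z → B z' → z ⪯ z' → Incident graph e v → Gain z' e → Gain z e
  gain-anti {z} {z'} {e} Bz Bz' pref inc g@(lt , lt') with gain? z e
  ... | yes gz = gz
  ... | no ngz = contradiction
    (<-≤-trans lt' (≤-trans (≤-reflexive (cong (λ u → lookup u e) (sym (proj₂ bump))))
      (≤-trans (C≤-nongain (proj₁ bump) (≼-trans (≼-⊔ʳ z' z) (≼-⊕ (z' ⊔ᵥ z) (unit e))) ngz) le)))
    (<-irrefl refl)
    where
    le = gain-≤ Bz Bz' pref g
    bump = C-bump-⊔ Bz Bz' pref inc lt le

  Exchange : Vec ℕ m → Fin m → Fin m → Set
  Exchange z a c = Cv (z ⊕ unit a) ⊕ unit c ≡ z ⊕ unit a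

  exchange-incident : B (z ⊕ unit a) → Exchange z a c → Incident graph c v
  exchange-incident {z} {a} {c} Bza ex = B-incident Bza
    (≤-trans (s≤s z≤n) (≤-reflexive (trans (sym (bump-self (Cv (z ⊕ unit a)) c)) (cong (λ u → lookup u c) ex))))

  -- Condition (C) needs strict preferences. If two consecutive positions coincide, the dropped edge
  -- is determined by the choice itself.
  gapless-⪯ : Gapless M v → Acc z₁ → Acc z₂ → Acc z₃ →
              z₁ ⪯ z₂ → z₂ ⪯ z₃ → Incident graph a v →
              B (z₁ ⊕ unit a) → B (z₂ ⊕ unit a) → B (z₃ ⊕ unit a) →
              ∀ {c c'} → Exchange z₁ a c → Exchange z₂ a c' → Exchange z₃ a c → c ≡ c'
  gapless-⪯ {z₁} {z₂} {z₃} {a} gap acc₁ acc₂ acc₃ p q inc B₁ B₂ B₃ {c} {c'} ex₁ ex₂ ex₃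
    with vec-≟ Data.Nat._≟_ z₁ z₂ | vec-≟ Data.Nat._≟_ z₂ z₃
  ... | yes refl | _ = unit-injective (sym ex₁) (sym ex₂)
  ... | no _ | yes refl = unit-injective (sym ex₃) (sym ex₂)
  ... | no ne | no ne' =
    gap z₁ z₂ z₃ a c c' c inc
      (exchange-incident B₁ ex₁) (exchange-incident B₂ ex₂) (exchange-incident B₁ ex₁)
      a₁ a₂ a₃ (a₁ , a₂ , ne , p) (a₂ , a₃ , ne' , q)
      (B⇒InB B₁) (B⇒InB B₂) (B⇒InB B₃) ex₁ ex₂ ex₃ refl
    where
    a₁ = Acc⇒Acceptable acc₁
    a₂ = Acc⇒Acceptable acc₂
    a₃ = Acc⇒Acceptable acc₃

  -- The existence of an exchange at `z₂` comes from sizes. Offered `a`, `z₂` cannot shrink; nor can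
  -- it outgrow `z₃`, because `z₂ ⊕ unit a` lies below the bumped join, whose choice has the size of
  -- `z₃`. Condition (C) then identifies the dropped edge.
  exchange-convex : Gapless M v → Acc z₁ → Acc z₂ → Acc z₃ →
                    z₁ ⪯ z₂ → z₂ ⪯ z₃ → sum z₃ ≡ sum z₂ → Incident graph a v → Gain z₃ a →
                    Exchange z₁ a c → Exchange z₃ a c → Exchange z₂ a c
  exchange-convex {z₁} {z₂} {z₃} {a} {c} gap acc₁@(B₁ , _) acc₂@(B₂ , C₂) acc₃@(B₃ , _) p q size inc g₃ ex₁ ex₃ =
    subst (Exchange z₂ a) (sym c≡c') ex₂
    where
    g₂ = gain-anti B₂ B₃ q inc g₃
    g₁ = gain-anti B₁ B₂ p inc g₂
    B₁⁺ = B-bump B₁ inc (proj₁ g₁)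
    B₂⁺ = B-bump B₂ inc (proj₁ g₂)
    B₃⁺ = B-bump B₃ inc (proj₁ g₃)
    bump = C-bump-⊔ B₂ B₃ q inc (proj₁ g₃) (gain-≤ B₂ B₃ q g₃)
    size₃ : sum (Cv (z₃ ⊕ unit a)) ≡ sum z₃
    size₃ = suc-injective (trans (sym (sum-bump (Cv (z₃ ⊕ unit a)) c)) (trans (cong sum ex₃) (sum-bump z₃ a)))
    upper : sum (Cv (z₂ ⊕ unit a)) ≤ sum z₂
    upper = begin
      sum (Cv (z₂ ⊕ unit a))            ≤⟨ C-size (proj₁ bump) (⊕-monoˡ (unit a) (≼-⊔ʳ z₃ z₂)) ⟩
      sum (Cv ((z₃ ⊔ᵥ z₂) ⊕ unit a))    ≡⟨ cong sum (proj₂ bump) ⟩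
      sum (Cv (z₃ ⊕ unit a))            ≡⟨ size₃ ⟩
      sum z₃                            ≡⟨ size ⟩
      sum z₂                            ∎
      where open ≤-Reasoning
    lower : sum z₂ ≤ sum (Cv (z₂ ⊕ unit a))
    lower = ≤-trans (≤-reflexive (cong sum (sym C₂))) (C-size B₂⁺ (≼-⊕ z₂ (unit a)))
    gap-one : ∃[ c' ] Exchange z₂ a c'
    gap-one = sum-gap-one (C≼ B₂⁺) (trans (sum-bump z₂ a) (cong suc (≤-antisym lower upper)))
    ex₂ = proj₂ gap-one
    c≡c' : c ≡ proj₁ gap-one
    c≡c' = gapless-⪯ gap acc₁ acc₂ acc₃ p q inc B₁⁺ B₂⁺ B₃⁺ ex₁ ex₂ ex₃

-- Stable g-matchings, envelopes and the order between them

module Stability (M : Market) where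
  open Market M using (m; p; q; b; graph; wEnd; fEnd)
  open Choice M using (feasible)

  private
    module C (v : Vertex p q) = Choice M v
    variable
      x y z : Vec ℕ m
      a c e : Fin m

  res : Vertex p q → Vec ℕ m → Vec ℕ m
  res = restrict M

  res-in : ∀ v x {e} → Incident graph e v → lookup (res v x) e ≡ lookup x e
  res-in v x {e} i
    rewrite lookup∘tabulate (λ e → if ⌊ incident? graph e v ⌋ then lookup x e else 0) e
    with incident? graph e v
  ... | yes _ = refl
  ... | no ni = contradiction i ni

  res-out : ∀ v x {e} → ¬ Incident graph e v → lookup (res v x) e ≡ 0
  res-out v x {e} ni
    rewrite lookup∘tabulate (λ e → if ⌊ incident? graph e v ⌋ then lookup x e else 0) e
    with incident? graph e v
  ... | yes i = contradiction i ni
  ... | no _  = refl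

  res-≼ : ∀ v x → res v x ≼ x
  res-≼ v x .at e with incident? graph e v
  ... | yes i = ≤-reflexive (res-in v x i)
  ... | no ni = ≤-trans (≤-reflexive (res-out v x ni)) z≤n

  res-glb : ∀ v {u x} → u ≼ x → (∀ e → ¬ Incident graph e v → lookup u e ≡ 0) → u ≼ res v x
  res-glb v {u} {x} le o .at e with incident? graph e v
  ... | yes i = ≤-trans (at le e) (≤-reflexive (sym (res-in v x i)))
  ... | no ni = ≤-trans (≤-reflexive (o e ni)) z≤n

  res-mono : ∀ v → x ≼ y → res v x ≼ res v y
  res-mono {x} v le = res-glb v (≼-trans (res-≼ v x) le) (λ e → res-out v x)

  res-B : ∀ v → x ≼ b → C.B v (res v x)
  res-B {x} v le = feasible (≼-trans (res-≼ v x) le) (λ e → res-out v x)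

  res-⊕ : ∀ v x y → res v (x ⊕ y) ≡ res v x ⊕ res v y
  res-⊕ v x y = lookup-ext eq
    where
    eq : ∀ e → lookup (res v (x ⊕ y)) e ≡ lookup (res v x ⊕ res v y) e
    eq e with incident? graph e v
    ... | yes i = trans (res-in v (x ⊕ y) i) (trans (⊕-at x y e) (sym (trans (⊕-at (res v x) (res v y) e)
      (cong₂ _+_ (res-in v x i) (res-in v y i)))))
    ... | no ni = trans (res-out v (x ⊕ y) ni) (sym (trans (⊕-at (res v x) (res v y) e)
      (cong₂ _+_ (res-out v x ni) (res-out v y ni))))

  record Up (x : Vec ℕ m) (e : Fin m) : Set where
    constructor wanted
    field gain : C.Gain (fv M e) (res (fv M e) x) e
  open Up

  up? : ∀ x e → Dec (Up x e)
  up? x e = map′ wanted gain (C.gain? (fv M e) (res (fv M e) x) e)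

  up-< : Up x e → lookup x e < lookup b e
  up-< {x} {e} (wanted (lt , _)) = ≤-<-trans (≤-reflexive (sym (res-in (fv M e) x refl))) lt

  record Stab (x : Vec ℕ m) : Set where
    field
      below   : x ≼ b
      acc     : ∀ v → C.Acc v (res v x)
      unblock : ∀ e → Up x e → ¬ C.Gain (wv M e) (res (wv M e) x) e
  open Stab

  UFplus⇒Up : Stab x → UFplus M x e → Up x e
  UFplus⇒Up {e = e} st i = wanted (C.interesting⇒gain (fv M e) (proj₁ (acc st _)) i)

  Up⇒UFplus : Stab x → Up x e → UFplus M x e
  Up⇒UFplus {e = e} st (wanted g) = C.gain⇒interesting (fv M e) (proj₁ (acc st _)) refl g

  Stable⇒Stab : Stable M x → Stab x
  Stable⇒Stab {x} ((le , accx) , nb) = record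
    { below = pointwise le
    ; acc = ac
    ; unblock = λ e (wanted gainF) gain → nb e
        (C.gain⇒interesting (wv M e) (proj₁ (ac _)) refl gain ,
         C.gain⇒interesting (fv M e) (proj₁ (ac _)) refl gainF) }
    where
    ac : ∀ v → C.Acc v (res v x)
    ac v = C.Acceptable⇒Acc v (accx v)

  Stab⇒Stable : Stab x → Stable M x
  Stab⇒Stable st = (at (below st) , λ v → C.Acc⇒Acceptable v (acc st v)) ,
    λ e (iw , if) → unblock st e (UFplus⇒Up st if) (C.interesting⇒gain (wv M e) (proj₁ (acc st _)) iw)

  -- Everything F wants at x, at full capacity: for every w the restriction of x is what C_w picks
  -- from this envelope, and no later stable g-matching leaves it.
  env : Vec ℕ m → Vec ℕ m
  env x = tabulate λ e → if ⌊ up? x e ⌋ then lookup b e else lookup x e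

  env-up : Up x e → lookup (env x) e ≡ lookup b e
  env-up {x} {e} up
    rewrite lookup∘tabulate (λ e → if ⌊ up? x e ⌋ then lookup b e else lookup x e) e
    with up? x e
  ... | yes _  = refl
  ... | no nup = contradiction up nup

  env-nonup : ¬ Up x e → lookup (env x) e ≡ lookup x e
  env-nonup {x} {e} nup
    rewrite lookup∘tabulate (λ e → if ⌊ up? x e ⌋ then lookup b e else lookup x e) e
    with up? x e
  ... | yes up = contradiction up nup
  ... | no _   = refl

  env-below : x ≼ b → env x ≼ b
  env-below {x} le .at e with up? x e
  ... | yes up = ≤-reflexive (env-up up)
  ... | no nup = ≤-trans (≤-reflexive (env-nonup nup)) (at le e)

  ≼-env : x ≼ b → x ≼ env x
  ≼-env {x} le .at e with up? x e
  ... | yes up = ≤-trans (at le e) (≤-reflexive (sym (env-up up)))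
  ... | no nup = ≤-reflexive (sym (env-nonup nup))

  env-B : Stab x → ∀ v → C.B v (res v (env x))
  env-B st v = res-B v (env-below (below st))

  res-≼-env : Stab x → ∀ v → res v x ≼ res v (env x)
  res-≼-env st v = res-mono v (≼-env (below st))

  -- At a wanted edge w has no gain, by stability, and elsewhere the envelope offers no more than x.
  -- So the choice stays below x, and (A1) gives equality.
  env-chosen : Stab x → ∀ w → C.Cv (inj₁ w) (res (inj₁ w) (env x)) ≡ res (inj₁ w) x
  env-chosen {x} st w =
    trans (sym (C.C-between v BE (res-≼-env st v) below-x)) (proj₂ (acc st v))
    where
    v = inj₁ w
    BE = env-B st v
    below-x : C.Cv v (res v (env x)) ≼ res v x
    below-x .at e with wEnd e ≟ᶠ w | up? x e
    ... | no ni | _ = ≤-trans (at (C.C≼ v BE) e) (≤-trans (≤-reflexive (res-out v (env x) ni)) z≤n)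
    ... | yes refl | yes up = C.C≤-nongain v BE (res-≼-env st v) (unblock st e up)
    ... | yes refl | no nup = ≤-trans (at (C.C≼ v BE) e) (≤-reflexive
      (trans (res-in v (env x) refl) (trans (env-nonup nup) (sym (res-in v x refl)))))

  -- Progress along a route. The W side appears as containment in the envelope: since w chooses x
  -- from `env x`, it says that w finds y no better than x.
  record Later (x y : Vec ℕ m) : Set where
    field
      better  : ∀ f → C._⪯_ (inj₂ f) (res (inj₂ f) x) (res (inj₂ f) y)
      bounded : y ≼ env x
      size    : ∀ v → sum (res v y) ≡ sum (res v x)
  open Later

  later-up : Stab x → Stab y → Later x y → Up y e → Up x e
  later-up {e = e} sx sy l (wanted g) =
    wanted (C.gain-anti (fv M e) (proj₁ (acc sx _)) (proj₁ (acc sy _)) (better l _) refl g)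

  -- As F fares better it wants fewer edges, so fewer are raised to full capacity; this makes the
  -- menus of W nested along a route.
  env-anti : Stab x → Stab y → Later x y → env y ≼ env x
  env-anti {x} {y} sx sy l .at e with up? y e
  ... | yes up = ≤-reflexive (trans (env-up up) (sym (env-up (later-up sx sy l up))))
  ... | no nup = ≤-trans (≤-reflexive (env-nonup nup)) (at (bounded l) e)

  later-refl : Stab x → Later x x
  later-refl st = record
    { better  = λ f → C.⪯-refl (inj₂ f) (acc st _)
    ; bounded = ≼-env (below st)
    ; size    = λ v → refl }

  later-trans : Stab x → Stab y → Stab z → Later x y → Later y z → Later x z
  later-trans sx sy sz l l' = record
    { better  = λ f → C.⪯-trans (inj₂ f) (proj₁ (acc sx _)) (proj₁ (acc sy _)) (proj₁ (acc sz _))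
                        (better l f) (better l' f)
    ; bounded = ≼-trans (bounded l') (env-anti sx sy l)
    ; size    = λ v → trans (size l' v) (size l v) }

  -- Convexity of F-pairs and of essential W-pairs

  LegalF-convex : (∀ v → Gapless M v) → Stab x → Stab y → Stab z → Later x y → Later y z →
                  LegalF M x a c → LegalF M z a c → LegalF M y a c
  LegalF-convex {a = a} gap sx sy sz l l' (ne , same , _ , ex) (_ , _ , upz , ex') =
    ne , same , Up⇒UFplus sy (later-up sy sz l' (UFplus⇒Up sz upz)) ,
    C.exchange-convex (fv M a) (gap _) (acc sx _) (acc sy _) (acc sz _)
      (better l _) (better l' _) (size l' (fv M a)) refl (gain (UFplus⇒Up sz upz)) ex ex'

  -- EssentialW with its two conditions on w merged into one equation, which is decidable and
  -- to which condition (C) applies.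
  record EnvelopeMove (x : Vec ℕ m) (c a : Fin m) : Set where
    field
      same-w : wEnd a ≡ wEnd c
      pos    : 0 < lookup x c
      nonup  : ¬ Up x c
      up     : Up x a
      move   : C.Cv (wv M c) (res (wv M c) (env x) ⊖ unit c) ⊕ unit c ≡ res (wv M c) x ⊕ unit a
  open EnvelopeMove

  -- How w reacts when one unit of an unwanted edge `c` leaves the envelope. By (A2) it keeps
  -- everything else it held, and by (A3) its size does not grow, so `S ⊕ unit c` exceeds `r` by at
  -- most one unit.
  module Withdraw (st : Stab x) (c : Fin m) (pos : 0 < lookup x c) (nonup : ¬ Up x c) where
    w : Vertex p q
    w = wv M c
    r E Z S : Vec ℕ m
    r = res w x
    E = res w (env x)
    Z = E ⊖ unit c
    S = C.Cv w Z

    BE : C.B w E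
    BE = env-B st w

    Z≼E : Z ≼ E
    Z≼E = ⊖-≼ E (unit c)

    BZ : C.B w Z
    BZ = C.B-down w BE Z≼E

    r≼E : r ≼ E
    r≼E = res-≼-env st w

    1≼r : unit c ≼ r
    1≼r = unit-≼ (<-≤-trans pos (≤-reflexive (sym (res-in w x refl))))

    CE : C.Cv w E ≡ r
    CE = env-chosen st (wEnd c)

    S⊕1≼E : S ⊕ unit c ≼ E
    S⊕1≼E = ≼-trans (⊕-monoˡ (unit c) (C.C≼ w BZ)) (≼-reflexive (⊖⊕-cancel (≼-trans 1≼r r≼E)))

    r⊖1≼S : r ⊖ unit c ≼ S
    r⊖1≼S .at e = C.C-keep w BE Z≼E e
      (≤-trans (at (⊖-≼ r (unit c)) e) (≤-reflexive (cong (λ u → lookup u e) (sym CE))))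
      (at (⊖-monoˡ (unit c) r≼E) e)

    r≼S⊕1 : r ≼ S ⊕ unit c
    r≼S⊕1 = ≼-trans (≼-reflexive (sym (⊖⊕-cancel 1≼r))) (⊕-monoˡ (unit c) r⊖1≼S)

    size-S : sum S ≤ sum r
    size-S = ≤-trans (C.C-size w BE Z≼E) (≤-reflexive (cong sum CE))

    -- With `c` restored, the menu lies between `r` and the envelope, so w returns to `r`: the move,
    -- read backwards, has the form that (C) requires.
    exchange : S ⊕ unit c ≡ r ⊕ unit a → C.Exchange w S c a
    exchange {a} eq = trans (cong (_⊕ unit a) (trans (C.C-between w BE S⊕1≼E CE≼) CE)) (sym eq)
      where
      CE≼ : C.Cv w E ≼ S ⊕ unit c
      CE≼ = ≼-trans (≼-reflexive CE) r≼S⊕1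

  -- The reduced menus shrink with time, so the choices from them satisfy `Z.S ⪯ Y.S ⪯ X.S` and (C)
  -- is used in that order. The smaller menu at z already yields the full size, which forces a
  -- one-unit difference at y.
  EnvelopeMove-convex : (∀ v → Gapless M v) → Stab x → Stab y → Stab z → Later x y → Later y z →
                        EnvelopeMove x c a → EnvelopeMove z c a → EnvelopeMove y c a
  EnvelopeMove-convex {x} {y} {z} {c} {a} gap sx sy sz l l' mx mz = record
    { same-w = same-w mx
    ; pos    = pos-y
    ; nonup  = nonup-y
    ; up     = later-up sy sz l' (up mz)
    ; move   = subst (λ d → Y.S ⊕ unit c ≡ Y.r ⊕ unit d) (sym a≡a') eq }
    where
    nonup-y : ¬ Up y c
    nonup-y u = nonup mx (later-up sx sy l u)
    pos-y : 0 < lookup y c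
    -- At an unwanted edge `env y` equals y, and z stays within `env y`.
    pos-y = <-≤-trans (pos mz) (≤-trans (at (bounded l') c) (≤-reflexive (env-nonup nonup-y)))
    module X = Withdraw sx c (pos mx) (nonup mx)
    module Y = Withdraw sy c pos-y nonup-y
    module Z = Withdraw sz c (pos mz) (nonup mz)
    Zy≼Zx : Y.Z ≼ X.Z
    Zy≼Zx = ⊖-monoˡ (unit c) (res-mono Y.w (env-anti sx sy l))
    Zz≼Zy : Z.Z ≼ Y.Z
    Zz≼Zy = ⊖-monoˡ (unit c) (res-mono Y.w (env-anti sy sz l'))
    size-Z : sum Z.S ≡ sum Y.r
    size-Z = trans (suc-injective (trans (sym (sum-bump Z.S c))
      (trans (cong sum (move mz)) (sum-bump Z.r a)))) (size l' (wv M c))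
    size-Y : sum Y.r ≤ sum Y.S
    size-Y = ≤-trans (≤-reflexive (sym size-Z)) (C.C-size Y.w Y.BZ Zz≼Zy)
    gap-one : ∃[ a' ] Y.r ⊕ unit a' ≡ Y.S ⊕ unit c
    gap-one = sum-gap-one Y.r≼S⊕1 (trans (sum-bump Y.S c) (cong suc (≤-antisym Y.size-S size-Y)))
    eq = sym (proj₂ gap-one)
    a≡a' : a ≡ proj₁ gap-one
    a≡a' = C.gapless-⪯ Y.w (gap _)
      (C.C-acceptable Y.w Z.BZ) (C.C-acceptable Y.w Y.BZ) (C.C-acceptable Y.w X.BZ)
      (C.chosen-⪯ Y.w Y.BZ refl (≼-trans (C.C≼ Y.w Z.BZ) Zz≼Zy))
      (C.chosen-⪯ Y.w X.BZ refl (≼-trans (C.C≼ Y.w Y.BZ) Zy≼Zx))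
      refl
      (C.B-down Y.w Z.BE Z.S⊕1≼E) (C.B-down Y.w Y.BE Y.S⊕1≼E) (C.B-down Y.w X.BE X.S⊕1≼E)
      (Z.exchange (move mz)) (Y.exchange eq) (X.exchange (move mx))

  wMove-cancel : 0 < lookup x c → wMove M x c a ⊕ unit c ≡ res (wv M c) x ⊕ unit a
  wMove-cancel {x} {c} {a} pos = ⊖⊕-cancel (unit-≼ (<-≤-trans pos
    (≤-trans (≤-reflexive (sym (res-in (wv M c) x refl))) (at (≼-⊕ (res (wv M c) x) (unit a)) c))))

  -- The move equation forces `wMove` to be `S`, acceptable as a choice. A wanted `d` differs from
  -- `c`, so the menu has it at full capacity; whatever w did not take of it was refused.
  EnvelopeMove⇒EssentialW : Stab x → EnvelopeMove x c a → EssentialW M x c a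
  EnvelopeMove⇒EssentialW {x} {c} {a} st mv =
    (same-w mv , (pos mv , λ i → nonup mv (UFplus⇒Up st i)) , Up⇒UFplus st (up mv) ,
     subst (Acceptable M w) (sym u≡S) (C.Acc⇒Acceptable w (C.C-acceptable w BZ))) ,
    λ d same upd ne int →
      nongain d same (UFplus⇒Up st upd) (subst (λ u → Interesting M w u d) u≡S int)
    where
    open Withdraw st c (pos mv) (nonup mv)
    u≡S : wMove M x c a ≡ S
    u≡S = trans (cong (_⊖ unit c) (sym (move mv))) (⊕⊖-cancel S (unit c))
    nongain : ∀ d → wEnd d ≡ wEnd c → Up x d → ¬ Interesting M w S d
    nongain d same upd int = C.chosen-nongain w BZ refl
      (<-≤-trans (proj₁ gain-d) (≤-reflexive (sym (trans (drop-other E d≢c)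
        (trans (res-in w (env x) same) (env-up upd)))))) gain-d
      where
      gain-d = C.interesting⇒gain w (proj₁ (C.C-acceptable w BZ)) int
      d≢c : d ≢ c
      d≢c refl = nonup mv upd

  -- It suffices to bound `S` by the acceptable `u` and apply (A1). Essentiality gives the bound at
  -- wanted edges other than `a`; at unwanted ones the envelope offers no more than x.
  EssentialW⇒EnvelopeMove : Stab x → EssentialW M x c a → EnvelopeMove x c a
  EssentialW⇒EnvelopeMove {x} {c} {a} st ((same , (pos , nup) , upa , accu) , ess) = record
    { same-w = same ; pos = pos ; nonup = nonup-c ; up = up-a
    ; move = trans (cong (_⊕ unit c) S≡u) (wMove-cancel {x = x} pos) }
    where
    nonup-c : ¬ Up x c
    nonup-c u = nup (Up⇒UFplus st u)
    up-a = UFplus⇒Up st upa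
    open Withdraw st c pos nonup-c
    u = wMove M x c a
    u≼Z : u ≼ Z
    u≼Z = ⊖-monoˡ (unit c) (bump-≼ r≼E (<-≤-trans
      (≤-<-trans (at (res-≼ w x) a) (up-< up-a))
      (≤-reflexive (sym (trans (res-in w (env x) same) (env-up up-a))))))
    sum-u : sum u ≡ sum r
    sum-u = suc-injective (trans (sym (sum-bump u c)) (trans (cong sum (wMove-cancel {x = x} pos)) (sum-bump r a)))
    u-other : ∀ {i} → i ≢ a → lookup u i ≡ lookup (r ⊖ unit c) i
    u-other {i} ne = trans (⊖-at (r ⊕ unit a) (unit c) i)
      (trans (cong (_∸ lookup (unit c) i) (bump-other r ne)) (sym (⊖-at r (unit c) i)))
    -- Essentiality says nothing about `a` itself. An excess there would make `S` strictly contain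
    -- `u`, against its size.
    S≤u-a : lookup S a ≤ lookup u a
    S≤u-a with lookup S a ≤? lookup u a
    ... | yes le = le
    ... | no nle = contradiction
      (≤-trans (≤-reflexive (sym (sum-bump u a)))
        (≤-trans (sum-mono (bump-≼ u≼S (≰⇒> nle))) (≤-trans size-S (≤-reflexive (sym sum-u))))) 1+n≰n
      where
      u≼S : u ≼ S
      u≼S .at i with i ≟ᶠ a
      ... | yes refl = <⇒≤ (≰⇒> nle)
      ... | no ne    = ≤-trans (≤-reflexive (u-other ne)) (at r⊖1≼S i)
    S≤u-capped : ∀ {i} → lookup E i ≡ lookup r i → lookup S i ≤ lookup u i
    S≤u-capped {i} E≡r = ≤-trans (at (C.C≼ w BZ) i) (≤-trans
      (≤-reflexive (trans (⊖-at E (unit c) i) (trans (cong (_∸ lookup (unit c) i) E≡r) (sym (⊖-at r (unit c) i)))))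
      (at (⊖-monoˡ (unit c) (≼-⊕ r (unit a))) i))
    S≼u : S ≼ u
    S≼u .at i with i ≟ᶠ a | wEnd i ≟ᶠ wEnd c | up? x i
    ... | yes refl | _ | _ = S≤u-a
    ... | no ne | yes inc | yes up-i = C.C≤-nongain w BZ u≼Z
      (λ g → ess i inc (Up⇒UFplus st up-i) ne
        (C.gain⇒interesting w (C.InB⇒B w (proj₁ accu)) inc g))
    ... | no _ | yes inc | no nup-i = S≤u-capped
      (trans (res-in w (env x) inc) (trans (env-nonup nup-i) (sym (res-in w x inc))))
    ... | no _ | no ni | _ = S≤u-capped (trans (res-out w (env x) ni) (sym (res-out w x ni)))
    S≡u : S ≡ u
    S≡u = trans (sym (C.C-between w BZ u≼Z S≼u)) (proj₂ accu)

  EssentialW-convex : (∀ v → Gapless M v) → Stab x → Stab y → Stab z → Later x y → Later y z →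
                      EssentialW M x c a → EssentialW M z c a → EssentialW M y c a
  EssentialW-convex gap sx sy sz l l' ex ez = EnvelopeMove⇒EssentialW sy
    (EnvelopeMove-convex gap sx sy sz l l'
      (EssentialW⇒EnvelopeMove sx ex) (EssentialW⇒EnvelopeMove sz ez))

  -- Decidability of pairs, and uniqueness of their second edge

  legalF? : Stab x → ∀ a c → Dec (LegalF M x a c)
  legalF? {x} st a c =
    ¬? (a ≟ᶠ c) ×-dec (fEnd c ≟ᶠ fEnd a) ×-dec
    map′ (Up⇒UFplus st) (UFplus⇒Up st) (up? x a) ×-dec vec-≟ Data.Nat._≟_ _ _

  essentialW? : Stab x → ∀ c a → Dec (EssentialW M x c a)
  essentialW? {x} st c a = map′ (EnvelopeMove⇒EssentialW st) (EssentialW⇒EnvelopeMove st)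
    (map′
      (λ (s , p , n , u , e) → record { same-w = s ; pos = p ; nonup = n ; up = u ; move = e })
      (λ mv → same-w mv , pos mv , nonup mv , up mv , move mv)
      ((wEnd a ≟ᶠ wEnd c) ×-dec (0 <? lookup x c) ×-dec ¬? (up? x c) ×-dec up? x a
        ×-dec vec-≟ Data.Nat._≟_ _ _))

  LegalF-functional : ∀ x {c c'} → LegalF M x a c → LegalF M x a c' → c ≡ c'
  LegalF-functional _ (_ , _ , _ , ex) (_ , _ , _ , ex') = unit-injective (sym ex) (sym ex')

  EssentialW-functional : ∀ {a a'} → Stab x → EssentialW M x c a → EssentialW M x c a' → a ≡ a'
  EssentialW-functional {x} st e e' =
    unit-injective (move (EssentialW⇒EnvelopeMove st e)) (move (EssentialW⇒EnvelopeMove st e'))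

  -- Adding one unit of an applicable rotation preserves stability

  sum-res-unit-in : ∀ v e → Incident graph e v → sum (res v (unit e)) ≡ 1
  sum-res-unit-in v e i = trans (cong sum (sym (≼-antisym (res-glb v ≼-refl off-e) (res-≼ v (unit e))))) (sum-unit e)
    where
    off-e : ∀ d → ¬ Incident graph d v → lookup (unit e) d ≡ 0
    off-e d ni = unit-other {e = e} {d} λ { refl → ni i }

  sum-res-unit-out : ∀ v e → ¬ Incident graph e v → sum (res v (unit e)) ≡ 0
  sum-res-unit-out v e ni = n≤0⇒n≡0 (≤-trans (sum-mono zero-≼) (≤-reflexive (sum-zero {m})))
    where
    zero-≼ : res v (unit e) ≼ tabulate λ _ → 0
    zero-≼ .at d with d ≟ᶠ e
    ... | yes refl = ≤-trans (≤-reflexive (res-out v (unit e) ni)) z≤n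
    ... | no ne = ≤-trans (at (res-≼ v (unit e)) d) (≤-trans (≤-reflexive (unit-other ne)) z≤n)

  sum-res-unit : ∀ v d e → (Incident graph d v → Incident graph e v) →
                 (Incident graph e v → Incident graph d v) →
                 sum (res v (unit d)) ≡ sum (res v (unit e))
  sum-res-unit v d e to from with incident? graph d v
  ... | yes i = trans (sum-res-unit-in v d i) (sym (sum-res-unit-in v e (to i)))
  ... | no ni = trans (sum-res-unit-out v d ni) (sym (sum-res-unit-out v e (ni ∘ from)))

  sum-res-count : ∀ {A : Set} v (g h : A → Fin m) {l} →
                  All (λ r → (Incident graph (g r) v → Incident graph (h r) v) ×
                             (Incident graph (h r) v → Incident graph (g r) v)) l →
                  sum (res v (count (map g l))) ≡ sum (res v (count (map h l)))
  sum-res-count v g h []                       = refl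
  sum-res-count v g h {r ∷ l} ((to , from) ∷ rest) = begin
    sum (res v (unit (g r) ⊕ count (map g l)))                ≡⟨ split g ⟩
    sum (res v (unit (g r))) + sum (res v (count (map g l)))  ≡⟨ cong₂ _+_ (sum-res-unit v (g r) (h r) to from) (sum-res-count v g h rest) ⟩
    sum (res v (unit (h r))) + sum (res v (count (map h l)))  ≡⟨ split h ⟨
    sum (res v (unit (h r) ⊕ count (map h l)))                ∎
    where
    open ≡-Reasoning
    split : ∀ g → sum (res v (unit (g r) ⊕ count (map g l))) ≡
                  sum (res v (unit (g r))) + sum (res v (count (map g l)))
    split g = trans (cong sum (res-⊕ v (unit (g r)) (count (map g l))))
      (sum-⊕ (res v (unit (g r))) (res v (count (map g l))))

  firsts seconds : Rotation M → List (Fin m)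
  firsts  = map proj₁
  seconds = map proj₂

  module UniqueFlatten where
    first∈ : ∀ R → e ∈ firsts R → e ∈ flatten M R
    first∈ (_ ∷ R) (here eq)  = here eq
    first∈ (_ ∷ R) (there e∈) = there (there (first∈ R e∈))

    second∈ : ∀ R → e ∈ seconds R → e ∈ flatten M R
    second∈ (_ ∷ R) (here eq)  = there (here eq)
    second∈ (_ ∷ R) (there e∈) = there (there (second∈ R e∈))

    unique-firsts : ∀ R → Unique (flatten M R) → Unique (firsts R)
    unique-firsts []      _                  = []
    unique-firsts (_ ∷ R) ((_ ∷ a∉) ∷ _ ∷ u) =
      ¬Any⇒All¬ (firsts R) (All¬⇒¬Any a∉ ∘ first∈ R) ∷ unique-firsts R u

    unique-seconds : ∀ R → Unique (flatten M R) → Unique (seconds R)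
    unique-seconds []      _            = []
    unique-seconds (_ ∷ R) (_ ∷ c∉ ∷ u) =
      ¬Any⇒All¬ (seconds R) (All¬⇒¬Any c∉ ∘ second∈ R) ∷ unique-seconds R u

  length-rotate1 : ∀ {A : Set} (l : List A) → length l ≡ length (rotate1 M l)
  length-rotate1 []      = refl
  length-rotate1 (x ∷ l) = sym (trans (length-++ l) (+-comm (length l) 1))

  arcsW : Rotation M → List ((Fin m × Fin m) × (Fin m × Fin m))
  arcsW R = zip R (rotate1 M R)

  module Turn {R : Rotation M} (st : Stab x) (ap : Applicable M x R) where
    open UniqueFlatten

    private
      unique = proj₁ (proj₂ ap)
      pairsF = proj₁ (proj₂ (proj₂ ap))
      pairsW = proj₂ (proj₂ (proj₂ ap))

    P N x⁺ : Vec ℕ m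
    P  = count (firsts R)
    N  = count (seconds R)
    -- The truncated subtraction is exact: every c_i is positive in x, see `balance`.
    x⁺ = (x ⊕ P) ⊖ N

    LegalF-first : e ∈ firsts R → ∃[ c ] LegalF M x e c
    LegalF-first e∈ with ∈-map⁻ proj₁ e∈
    ... | (_ , c) , r∈ , refl = c , All-lookup pairsF r∈

    LegalF-second : e ∈ seconds R → ∃[ a ] a ∈ firsts R × LegalF M x a e
    LegalF-second e∈ with ∈-map⁻ proj₂ e∈
    ... | (a , _) , r∈ , refl = a , ∈-map⁺ proj₁ r∈ , All-lookup pairsF r∈

    EssentialW-first : e ∈ firsts R → ∃[ c ] c ∈ seconds R × EssentialW M x c e
    EssentialW-first e∈ with ∈-map⁻ proj₁ e∈
    ... | r , r∈ , refl
      with ∈-map⁻ proj₂ (subst (r ∈_) (sym (map-proj₂-zip R (rotate1 M R) (length-rotate1 R))) (∈-rotate1 R r∈))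
      where
      ∈-rotate1 : ∀ {r} R → r ∈ R → r ∈ rotate1 M R
      ∈-rotate1 (_ ∷ R) (here refl) = ∈-++⁺ʳ R (here refl)
      ∈-rotate1 (_ ∷ R) (there r∈)  = ∈-++⁺ˡ r∈
    ... | (q , _) , qr∈ , refl = proj₂ q ,
      ∈-map⁺ proj₂ (subst (q ∈_) (map-proj₁-zip R (rotate1 M R) (length-rotate1 R)) (∈-map⁺ proj₁ qr∈)) ,
      All-lookup pairsW qr∈

    EssentialW-second : e ∈ seconds R → ∃[ a ] EssentialW M x e a
    EssentialW-second e∈ with ∈-map⁻ proj₂ e∈
    ... | r , r∈ , refl
      with ∈-map⁻ proj₁ (subst (r ∈_) (sym (map-proj₁-zip R (rotate1 M R) (length-rotate1 R))) r∈)
    ... | (_ , q) , rq∈ , refl = proj₁ q , All-lookup pairsW rq∈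

    up-first : e ∈ firsts R → Up x e
    up-first e∈ = UFplus⇒Up st (proj₁ (proj₂ (proj₂ (proj₂ (LegalF-first e∈)))))

    second-move : (e∈ : e ∈ seconds R) → EnvelopeMove x e (proj₁ (EssentialW-second e∈))
    second-move e∈ = EssentialW⇒EnvelopeMove st (proj₂ (EssentialW-second e∈))

    ∉-seconds : Up x e → e ∉ seconds R
    ∉-seconds u e∈ = nonup (second-move e∈) u

    _∈ᶠ?_ : ∀ (e : Fin m) l → Dec (e ∈ l)
    _∈ᶠ?_ = _∈?_ _≟ᶠ_

    P≡1 : e ∈ firsts R → lookup P e ≡ 1
    P≡1 = count-∈ (unique-firsts R unique)

    P≡0 : e ∉ firsts R → lookup P e ≡ 0
    P≡0 = count-∉ (firsts R)

    N≡1 : e ∈ seconds R → lookup N e ≡ 1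
    N≡1 = count-∈ (unique-seconds R unique)

    N≡0 : e ∉ seconds R → lookup N e ≡ 0
    N≡0 = count-∉ (seconds R)

    N≼x : N ≼ x
    N≼x .at e with e ∈ᶠ? seconds R
    ... | yes e∈ = ≤-trans (≤-reflexive (N≡1 e∈)) (pos (second-move e∈))
    ... | no e∉  = ≤-trans (≤-reflexive (N≡0 e∉)) z≤n

    x⊕P≼b : x ⊕ P ≼ b
    x⊕P≼b .at e with e ∈ᶠ? firsts R
    ... | yes e∈ = ≤-trans (≤-reflexive (trans (⊕-at x P e) (trans (cong (lookup x e +_) (P≡1 e∈)) (+-comm _ 1))))
      (up-< (up-first e∈))
    ... | no e∉ = ≤-trans (≤-reflexive (trans (⊕-at x P e) (trans (cong (lookup x e +_) (P≡0 e∉)) (+-identityʳ _))))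
      (at (below st) e)

    balance : x⁺ ⊕ N ≡ x ⊕ P
    balance = ⊖⊕-cancel (≼-trans N≼x (≼-⊕ x P))

    x⁺≼b : x⁺ ≼ b
    x⁺≼b = ≼-trans (⊖-≼ (x ⊕ P) N) x⊕P≼b

    x⁺-at : ∀ e → lookup x⁺ e ≡ lookup x e + lookup P e ∸ lookup N e
    x⁺-at e = trans (⊖-at (x ⊕ P) N e) (cong (_∸ lookup N e) (⊕-at x P e))

    -- At f the edges of each (a_i, c_i) cancel. At w those of (c_i, a_{i+1}) do, so the list of the
    -- a_i is shifted cyclically first.
    sumP≡sumN : ∀ v → sum (res v P) ≡ sum (res v N)
    sumP≡sumN (inj₂ f) = sum-res-count (inj₂ f) proj₁ proj₂
      (All-map (λ (_ , same , _) → trans same , trans (sym same)) pairsF)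
    sumP≡sumN (inj₁ w) = begin
      sum (res v (count (firsts R)))                          ≡⟨ cong (sum ∘ res v) (rotate R) ⟨
      sum (res v (count (firsts (rotate1 M R))))              ≡⟨ cong (λ l → sum (res v (count (firsts l)))) (map-proj₂-zip R (rotate1 M R) (length-rotate1 R)) ⟨
      sum (res v (count (firsts (map proj₂ (arcsW R)))))      ≡⟨ cong (sum ∘ res v ∘ count) (map-∘ (arcsW R)) ⟨
      sum (res v (count (map (proj₁ ∘ proj₂) (arcsW R))))     ≡⟨ sum-res-count v (proj₁ ∘ proj₂) (proj₂ ∘ proj₁) (All-map (λ {pp} → same-end pp) pairsW) ⟩
      sum (res v (count (map (proj₂ ∘ proj₁) (arcsW R))))     ≡⟨ cong (sum ∘ res v ∘ count) (map-∘ (arcsW R)) ⟩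
      sum (res v (count (seconds (map proj₁ (arcsW R)))))     ≡⟨ cong (λ l → sum (res v (count (seconds l)))) (map-proj₁-zip R (rotate1 M R) (length-rotate1 R)) ⟩
      sum (res v (count (seconds R)))                         ∎
      where
      open ≡-Reasoning
      v = inj₁ w
      same-end : ∀ (pp : (Fin m × Fin m) × (Fin m × Fin m)) →
                 EssentialW M x (proj₂ (proj₁ pp)) (proj₁ (proj₂ pp)) →
                 (wEnd (proj₁ (proj₂ pp)) ≡ w → wEnd (proj₂ (proj₁ pp)) ≡ w) ×
                 (wEnd (proj₂ (proj₁ pp)) ≡ w → wEnd (proj₁ (proj₂ pp)) ≡ w)
      same-end _ ((same , _) , _) = trans (sym same) , trans same
      rotate : ∀ R → count (firsts (rotate1 M R)) ≡ count (firsts R)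
      rotate []      = refl
      rotate (r ∷ R) = trans (cong count (map-++ proj₁ R [ r ])) (count-∷ʳ (proj₁ r) (firsts R))

    size⁺ : ∀ v → sum (res v x⁺) ≡ sum (res v x)
    size⁺ v = +-cancelʳ-≡ (sum (res v N)) _ _ (begin
      sum (res v x⁺) + sum (res v N) ≡⟨ sum-⊕ (res v x⁺) (res v N) ⟨
      sum (res v x⁺ ⊕ res v N)       ≡⟨ cong sum (res-⊕ v x⁺ N) ⟨
      sum (res v (x⁺ ⊕ N))           ≡⟨ cong (sum ∘ res v) balance ⟩
      sum (res v (x ⊕ P))            ≡⟨ cong sum (res-⊕ v x P) ⟩
      sum (res v x ⊕ res v P)        ≡⟨ sum-⊕ (res v x) (res v P) ⟩
      sum (res v x) + sum (res v P)  ≡⟨ cong (sum (res v x) +_) (sumP≡sumN v) ⟩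
      sum (res v x) + sum (res v N)  ∎)
      where open ≡-Reasoning

    -- Each single exchange shows that f, offered all the aᵢ at once, drops every cᵢ; by size
    -- monotonicity it drops nothing else.
    chosenF : ∀ f → C.Cv (inj₂ f) (res (inj₂ f) (x ⊕ P)) ≡ res (inj₂ f) x⁺
    chosenF f = ≼∧sum≥⇒≡ C≼x⁺ (≤-trans (≤-reflexive (size⁺ v))
      (≤-trans (≤-reflexive (cong sum (sym (proj₂ (acc st v))))) (C.C-size v BZ (res-mono v (≼-⊕ x P)))))
      where
      v = inj₂ f
      BZ = res-B v x⊕P≼b
      C≼x⁺ : C.Cv v (res v (x ⊕ P)) ≼ res v x⁺
      C≼x⁺ .at e with fEnd e ≟ᶠ f | e ∈ᶠ? seconds R
      ... | no ni | _ = ≤-trans (at (C.C≼ v BZ) e) (≤-trans (≤-reflexive (res-out v (x ⊕ P) ni)) z≤n)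
      ... | yes inc | no e∉ = ≤-trans (at (C.C≼ v BZ) e) (≤-reflexive (trans (res-in v (x ⊕ P) inc)
        (trans (sym (trans (⊖-at (x ⊕ P) N e) (cong (lookup (x ⊕ P) e ∸_) (N≡0 e∉)))) (sym (res-in v x⁺ inc)))))
      ... | yes refl | yes e∈ = drop-second (LegalF-second e∈)
        where
        P≡0-e : lookup P e ≡ 0
        P≡0-e = P≡0 λ e∈₁ → nonup (second-move e∈) (up-first e∈₁)
        drop-second : ∃[ a ] a ∈ firsts R × LegalF M x a e →
                      lookup (C.Cv v (res v (x ⊕ P))) e ≤ lookup (res v x⁺) e
        drop-second (a , a∈ , a≢e , same , _ , ex) = s≤s⁻¹ (begin-strict
          lookup (C.Cv v Z) e                ≤⟨ C.C-keep v BZ one≼Z e ≤-refl (≤-trans (at (C.C≼ v BZ) e) (≤-reflexive Ze)) ⟩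
          lookup (C.Cv v (r ⊕ unit a)) e     <⟨ ≤-reflexive (trans (sym (bump-self (C.Cv v (r ⊕ unit a)) e)) (cong (λ u → lookup u e) ex-e)) ⟩
          lookup (r ⊕ unit a) e              ≡⟨ bump-other r (a≢e ∘ sym) ⟩
          lookup r e                         ≡⟨ res-in v x refl ⟩
          lookup x e                         ≡⟨ m+[n∸m]≡n (pos (second-move e∈)) ⟨
          suc (lookup x e ∸ 1)               ≡⟨ cong suc (cong₂ _∸_ (+-identityʳ (lookup x e)) (N≡1 e∈)) ⟨
          suc (lookup x e + 0 ∸ lookup N e)  ≡⟨ cong (λ u → suc (lookup x e + u ∸ lookup N e)) P≡0-e ⟨
          suc (lookup x e + lookup P e ∸ lookup N e) ≡⟨ cong suc (trans (res-in v x⁺ refl) (x⁺-at e)) ⟨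
          suc (lookup (res v x⁺) e)          ∎)
          where
          open ≤-Reasoning
          Z = res v (x ⊕ P)
          r = res v x
          ex-e : C.Exchange v r a e
          ex-e = subst (λ g → C.Exchange (inj₂ g) (res (inj₂ g) x) a e) (sym same) ex
          one≼Z : r ⊕ unit a ≼ Z
          one≼Z = res-glb v
            (bump-≼ (≼-trans (res-≼ v x) (≼-⊕ x P))
              (≤-<-trans (at (res-≼ v x) a) (≤-reflexive (sym (trans (⊕-at x P a)
                (trans (cong (lookup x a +_) (P≡1 a∈)) (+-comm _ 1)))))))
            (λ d ni → trans (bump-other r λ { refl → ni (sym same) }) (res-out v x ni))
          Ze : lookup Z e ≡ lookup (r ⊕ unit a) e
          Ze = trans (res-in v (x ⊕ P) refl) (trans (⊕-at x P e) (trans (cong (lookup x e +_) P≡0-e)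
            (trans (+-identityʳ _) (sym (trans (bump-other r (a≢e ∘ sym)) (res-in v x refl))))))

    BY : ∀ w → C.B (inj₁ w) (res (inj₁ w) (env x ⊖ N))
    BY w = res-B (inj₁ w) (≼-trans (⊖-≼ (env x) N) (env-below (below st)))

    -- Dually, each single move shows that w, deprived of all the cᵢ at once, takes every aᵢ.
    chosenW : ∀ w → C.Cv (inj₁ w) (res (inj₁ w) (env x ⊖ N)) ≡ res (inj₁ w) x⁺
    chosenW w = sym (≼∧sum≥⇒≡ x⁺≼C (≤-trans
      (C.C-size v BE (res-mono v (⊖-≼ (env x) N)))
      (≤-reflexive (trans (cong sum (env-chosen st w)) (sym (size⁺ v))))))
      where
      v = inj₁ w
      BE = env-B st v
      Y = res v (env x ⊖ N)
      x⁺≼C : res v x⁺ ≼ C.Cv v Y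
      x⁺≼C .at e with wEnd e ≟ᶠ w | e ∈ᶠ? firsts R
      ... | no ni | _ = ≤-trans (≤-reflexive (res-out v x⁺ ni)) z≤n
      ... | yes inc | no e∉ = C.C-keep v BE (res-mono v (⊖-≼ (env x) N)) e
        (≤-trans (≤-reflexive x⁺e) (≤-trans (m∸n≤m _ (lookup N e))
          (≤-reflexive (trans (sym (res-in v x inc)) (cong (λ u → lookup u e) (sym (env-chosen st w)))))))
        (≤-trans (≤-reflexive x⁺e) (≤-trans (∸-monoˡ-≤ (lookup N e) (at (≼-env (below st)) e))
          (≤-reflexive (sym (trans (res-in v (env x ⊖ N) inc) (⊖-at (env x) N e))))))
        where
        x⁺e : lookup (res v x⁺) e ≡ lookup x e ∸ lookup N e
        x⁺e = trans (res-in v x⁺ inc) (trans (x⁺-at e) (cong (_∸ lookup N e)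
          (trans (cong (lookup x e +_) (P≡0 e∉)) (+-identityʳ _))))
      ... | yes inc | yes e∈ = take-first (EssentialW-first e∈)
        where
        up-e = up-first e∈
        take-first : ∃[ c ] c ∈ seconds R × EssentialW M x c e → lookup (res v x⁺) e ≤ lookup (C.Cv v Y) e
        take-first (c , c∈ , ess) with trans (sym (same-w (EssentialW⇒EnvelopeMove st ess))) inc
        -- The menu deprived of `c` alone contains `Y`, and its choice takes the extra unit of `e`;
        -- full capacity at `e` leaves room for that unit in `Y`.
        ... | refl = C.C-keep v W.BZ Y≼Z e (≤-reflexive (trans x⁺e (sym Se)))
          (≤-trans (≤-reflexive x⁺e) (≤-trans (up-< up-e) (≤-reflexive (sym Ye))))
          where
          mv = EssentialW⇒EnvelopeMove st ess
          module W = Withdraw st c (pos mv) (nonup mv)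
          e≢c : e ≢ c
          e≢c refl = nonup mv up-e
          x⁺e : lookup (res v x⁺) e ≡ suc (lookup x e)
          x⁺e = trans (res-in v x⁺ inc) (trans (x⁺-at e) (trans
            (cong₂ (λ i j → lookup x e + i ∸ j) (P≡1 e∈) (N≡0 (∉-seconds up-e))) (+-comm (lookup x e) 1)))
          Se : lookup W.S e ≡ suc (lookup x e)
          Se = trans (sym (bump-other W.S e≢c)) (trans (cong (λ u → lookup u e) (move mv))
            (trans (bump-self W.r e) (cong suc (res-in v x inc))))
          Ye : lookup Y e ≡ lookup b e
          Ye = trans (res-in v (env x ⊖ N) inc) (trans (⊖-at (env x) N e)
            (cong₂ _∸_ (env-up up-e) (N≡0 (∉-seconds up-e))))
          Y≼Z : Y ≼ W.Z
          Y≼Z .at d with wEnd d ≟ᶠ wEnd c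
          ... | no ni = ≤-trans (≤-reflexive (res-out v (env x ⊖ N) ni)) z≤n
          ... | yes i = begin
            lookup Y d                                   ≡⟨ trans (res-in v (env x ⊖ N) i) (⊖-at (env x) N d) ⟩
            lookup (env x) d ∸ lookup N d                ≤⟨ ∸-monoʳ-≤ (lookup (env x) d) (at (unit-≼-count (seconds R) c∈) d) ⟩
            lookup (env x) d ∸ lookup (unit c) d         ≡⟨ cong (_∸ lookup (unit c) d) (res-in v (env x) i) ⟨
            lookup (res v (env x)) d ∸ lookup (unit c) d ≡⟨ ⊖-at (res v (env x)) (unit c) d ⟨
            lookup W.Z d                                 ∎
            where open ≤-Reasoning

    acc⁺ : ∀ v → C.Acc v (res v x⁺)
    acc⁺ (inj₁ w) = subst (C.Acc (inj₁ w)) (chosenW w) (C.C-acceptable (inj₁ w) (BY w))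
    acc⁺ (inj₂ f) = subst (C.Acc (inj₂ f)) (chosenF f) (C.C-acceptable (inj₂ f) (res-B (inj₂ f) x⊕P≼b))

    better⁺ : ∀ f → C._⪯_ (inj₂ f) (res (inj₂ f) x) (res (inj₂ f) x⁺)
    better⁺ f = C.chosen-⪯ (inj₂ f) (res-B (inj₂ f) x⊕P≼b) (chosenF f) (res-mono (inj₂ f) (≼-⊕ x P))

    later⁺ : Later x x⁺
    later⁺ = record { better = better⁺ ; bounded = bounded⁺ ; size = size⁺ }
      where
      bounded⁺ : x⁺ ≼ env x
      bounded⁺ .at e with e ∈ᶠ? firsts R
      ... | yes e∈ = ≤-trans (at x⁺≼b e) (≤-reflexive (sym (env-up (up-first e∈))))
      ... | no e∉ = ≤-trans (≤-reflexive (x⁺-at e)) (≤-trans (m∸n≤m _ (lookup N e)) (≤-trans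
        (≤-reflexive (trans (cong (lookup x e +_) (P≡0 e∉)) (+-identityʳ _))) (at (≼-env (below st)) e)))

    stab⁺ : Stab x⁺
    stab⁺ = record { below = x⁺≼b ; acc = acc⁺ ; unblock = unblock⁺ }
      where
      unblock⁺ : ∀ e → Up x⁺ e → ¬ C.Gain (wv M e) (res (wv M e) x⁺) e
      -- An edge wanted at `x⁺` was wanted at x, hence stood at full capacity in the menu from which
      -- w chose `x⁺`.
      unblock⁺ e (wanted g) g' = C.chosen-nongain (wv M e) (BY _) (chosenW _)
        (<-≤-trans (proj₁ g') (≤-reflexive (sym (trans (res-in (wv M e) (env x ⊖ N) refl)
          (trans (⊖-at (env x) N e) (cong₂ _∸_ (env-up up-e) (N≡0 (∉-seconds up-e)))))))) g'
        where
        up-e : Up x e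
        up-e = wanted (C.gain-anti (fv M e) (proj₁ (acc st _)) (proj₁ (acc⁺ _)) (better⁺ _) refl g)

  -- Iterating a rotation

  shift-unique : ∀ x i R y y' → Shift M x i R y → Shift M x i R y' → y ≡ y'
  shift-unique x i R y y' s s' = lookup-ext λ e → +-cancelʳ-≡ _ _ _ (trans (s e) (sym (s' e)))

  shift-suc : ∀ x y z i R → Shift M x i R y → Shift M y 1 R z → Shift M x (suc i) R z
  shift-suc x y z i R s s' e = begin
    lookup z e + (n + i * n)       ≡⟨ +-assoc (lookup z e) n _ ⟨
    lookup z e + n + i * n         ≡⟨ cong (λ u → lookup z e + u + i * n) (*-identityˡ n) ⟨
    lookup z e + 1 * n + i * n     ≡⟨ cong (_+ i * n) (s' e) ⟩
    lookup y e + 1 * p' + i * n    ≡⟨ cong (λ u → lookup y e + u + i * n) (*-identityˡ p') ⟩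
    lookup y e + p' + i * n        ≡⟨ +-assoc (lookup y e) p' _ ⟩
    lookup y e + (p' + i * n)      ≡⟨ cong (lookup y e +_) (+-comm p' _) ⟩
    lookup y e + (i * n + p')      ≡⟨ +-assoc (lookup y e) _ p' ⟨
    lookup y e + i * n + p'        ≡⟨ cong (_+ p') (s e) ⟩
    lookup x e + i * p' + p'       ≡⟨ +-assoc (lookup x e) _ p' ⟩
    lookup x e + (i * p' + p')     ≡⟨ cong (lookup x e +_) (+-comm _ p') ⟩
    lookup x e + (p' + i * p')     ∎
    where
    open ≡-Reasoning
    n  = chiMinus M R e
    p' = chiPlus M R e

  turn : ∀ {R} → Stab x → Applicable M x R → ∃[ y ] (Shift M x 1 R y × Stab y × Later x y)
  turn {x} {R} st ap = T.x⁺ , shift , T.stab⁺ , T.later⁺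
    where
    module T = Turn st ap
    shift : Shift M x 1 R T.x⁺
    shift e = begin
      lookup T.x⁺ e + 1 * chiMinus M R e  ≡⟨ cong (lookup T.x⁺ e +_) (trans (*-identityˡ _) (count-filter proj₂ R e)) ⟩
      lookup T.x⁺ e + lookup T.N e        ≡⟨ ⊕-at T.x⁺ T.N e ⟨
      lookup (T.x⁺ ⊕ T.N) e               ≡⟨ cong (λ u → lookup u e) T.balance ⟩
      lookup (x ⊕ T.P) e                  ≡⟨ ⊕-at x T.P e ⟩
      lookup x e + lookup T.P e           ≡⟨ cong (lookup x e +_) (trans (*-identityˡ _) (count-filter proj₁ R e)) ⟨
      lookup x e + 1 * chiPlus M R e      ∎
      where open ≡-Reasoning

  -- `Feasible` grants stability but no comparison, so the unit steps are retraced with `turn`;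
  -- uniqueness of shifts identifies the result with the vector at which R is known to be
  -- applicable.
  feasible-later : ∀ {R n} → Stab x → Feasible M x R n →
                   ∀ i → i ≤ n → ∃[ y ] (Shift M x i R y × Stab y × Later x y)
  feasible-later {x} st _ zero _ = x , (λ e → refl) , st , later-refl st
  feasible-later {x} {R} st F@(_ , _ , apps) (suc i) i<n
    with feasible-later st F i (<⇒≤ i<n) | apps i i<n
  ... | y , s , sy , l | y' , s' , ap with shift-unique x i R y y' s s'
  ... | refl with turn sy ap
  ... | z , s₁ , sz , l₁ = z , shift-suc x y z i R s s₁ , sz , later-trans st sy sz l l₁

-- Cyclic lists and first indices

rotation-induction : ∀ {A : Set} (Q : List A → Set) → (∀ x l → Q (x ∷ l) → Q (l ++ [ x ])) →
                     ∀ l l' → Q (l ++ l') → Q (l' ++ l)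
rotation-induction Q step []      l' q = subst Q (sym (++-identityʳ l')) q
rotation-induction Q step (x ∷ l) l' q = subst Q (++-assoc l' [ x ] l)
  (rotation-induction Q step l (l' ++ [ x ]) (subst Q (++-assoc l l' [ x ]) (step x (l ++ l') q)))

zip-∷ʳ : ∀ {A B : Set} (l : List A) (l' : List B) {x y} → length l ≡ length l' →
         zip (l ++ [ x ]) (l' ++ [ y ]) ≡ zip l l' ++ [ x , y ]
zip-∷ʳ []      []        _  = refl
zip-∷ʳ (a ∷ l) (b ∷ l') eq = cong ((a , b) ∷_) (zip-∷ʳ l l' (suc-injective eq))

-- Compares two cuts of one list; needed when equal cycles have been opened at a common edge but are
-- written from different starting points.
++-overlap : ∀ {A : Set} (k l k' l' : List A) → k ++ l ≡ k' ++ l' →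
             ∃[ o ] ((k ≡ k' ++ o × l' ≡ o ++ l) ⊎ (k' ≡ k ++ o × l ≡ o ++ l'))
++-overlap []      l k'       l' eq = k' , inj₂ (refl , eq)
++-overlap (x ∷ k) l []       l' eq = x ∷ k , inj₁ (refl , sym eq)
++-overlap (x ∷ k) l (x' ∷ k') l' eq with ∷-injective eq
... | refl , eq' with ++-overlap k l k' l' eq'
... | o , inj₁ (p , q) = o , inj₁ (cong (x ∷_) p , q)
... | o , inj₂ (p , q) = o , inj₂ (cong (x ∷_) p , q)

-- Failure is reported only at the predecessor; convexity of arcs later extends it to all earlier
-- members.
first-time : ∀ {n} {P : Fin (suc n) → Set} → (∀ i → Dec (P i)) → ∃ P →
             ∃[ t ] (P t × (t ≡ zero ⊎ ∃[ s ] (t ≡ suc s × ¬ P (inject₁ s))))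
first-time P? (j , pj) with P? zero
... | yes p₀ = zero , p₀ , inj₁ refl
first-time P? (zero , p₀) | no ¬p₀ = contradiction p₀ ¬p₀
first-time {suc n} P? (suc j , pj) | no ¬p₀ with first-time (P? ∘ suc) (j , pj)
... | t , pt , inj₁ refl = suc t , pt , inj₂ (zero , refl , ¬p₀)
... | t , pt , inj₂ (s , refl , ¬ps) = suc t , pt , inj₂ (suc s , refl , ¬ps)

-- Arcs, and recovery of a rotation from one of its edges

module Rotations (M : Market) where
  open Market M using (m)
  open Stability M

  private variable
    x y z : Vec ℕ m

  Arc : Set
  Arc = (Fin m × Fin m) ⊎ (Fin m × Fin m)

  Present : Vec ℕ m → Arc → Set
  Present x (inj₁ (a , c)) = LegalF M x a c
  Present x (inj₂ (c , a)) = EssentialW M x c a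

  present? : Stab x → ∀ α → Dec (Present x α)
  present? st (inj₁ (a , c)) = legalF? st a c
  present? st (inj₂ (c , a)) = essentialW? st c a

  present-convex : (∀ v → Gapless M v) → Stab x → Stab y → Stab z → Later x y → Later y z →
                   ∀ α → Present x α → Present z α → Present y α
  present-convex gap sx sy sz l l' (inj₁ _) = LegalF-convex gap sx sy sz l l'
  present-convex gap sx sy sz l l' (inj₂ _) = EssentialW-convex gap sx sy sz l l'

  linkW : (Fin m × Fin m) × (Fin m × Fin m) → Arc
  linkW ((_ , c) , (a , _)) = inj₂ (c , a)

  arcs : Rotation M → List Arc
  arcs R = map inj₁ R ++ map linkW (arcsW R)

  Legal : Vec ℕ m → Rotation M → Set
  Legal x R = All (Present x) (arcs R)

  legal⁺ : ∀ {R} → All (λ (a , c) → LegalF M x a c) R →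
           All (λ (r , r') → EssentialW M x (proj₂ r) (proj₁ r')) (arcsW R) → Legal x R
  legal⁺ pF pW = All-++⁺ (All-map⁺ pF) (All-map⁺ pW)

  legal⁻ : ∀ R → Legal x R → All (λ (a , c) → LegalF M x a c) R ×
                             All (λ (r , r') → EssentialW M x (proj₂ r) (proj₁ r')) (arcsW R)
  legal⁻ R l = All-map⁻ (All-++⁻ˡ (map inj₁ R) l) , All-map⁻ (All-++⁻ʳ (map inj₁ R) l)

  applicable⇒legal : ∀ {R} → Applicable M x R → Legal x R
  applicable⇒legal (_ , _ , pF , pW) = legal⁺ pF pW

  legal⇒applicable : ∀ x R → Applicable M x R → Legal y R → Applicable M y R
  legal⇒applicable _ R (ne , u , _) l = ne , u , legal⁻ R l

  legal-rotate : ∀ r R → Legal x (r ∷ R) → Legal x (R ++ [ r ])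
  legal-rotate r [] l = l
  legal-rotate r (r' ∷ R) l with legal⁻ (r ∷ r' ∷ R) l
  ... | fr ∷ fs , wr ∷ ws = legal⁺ (All-++⁺ fs (fr ∷ []))
    (subst (All _) (sym (zip-∷ʳ (r' ∷ R) (R ++ [ r ]) (length-rotate1 (r ∷ R)))) (All-++⁺ ws (wr ∷ [])))

  legal-same : ∀ {R R'} → SameRotation M R R' → Legal x R' → Legal x R
  legal-same {x} (l₁ , l₂ , refl , refl) = rotation-induction (Legal x) legal-rotate l₂ l₁

  same-sym : ∀ {R R'} → SameRotation M R R' → SameRotation M R' R
  same-sym (l₁ , l₂ , p , q) = l₂ , l₁ , q , p

  -- One of the a_i for either kind of arc, so rotations with a common arc share a first edge.
  arc-end : Arc → Fin m
  arc-end (inj₁ (a , _)) = a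
  arc-end (inj₂ (_ , a)) = a

  arc-end∈firsts : ∀ R {α} → α ∈ arcs R → arc-end α ∈ firsts R
  arc-end∈firsts R α∈ with ∈-++⁻ (map inj₁ R) α∈
  ... | inj₁ α∈F with ∈-map⁻ inj₁ α∈F
  ...   | r , r∈ , refl = ∈-map⁺ proj₁ r∈
  arc-end∈firsts R α∈ | inj₂ α∈W with ∈-map⁻ linkW α∈W
  ...   | (r , r') , rr∈ , refl = ∈-map⁺ proj₁ (∈-unrotate R
    (subst (r' ∈_) (map-proj₂-zip R (rotate1 M R) (length-rotate1 R)) (∈-map⁺ proj₂ rr∈)))
    where
    ∈-unrotate : ∀ {r} R → r ∈ rotate1 M R → r ∈ R
    ∈-unrotate (s ∷ R) r∈ with ∈-++⁻ R r∈
    ... | inj₁ r∈       = there r∈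
    ... | inj₂ (here eq) = here eq

  -- From the common start `r` each W-arc and then each F-arc leaves no alternative. The chains also
  -- stop together: if only one closed up at `p`, the other would meet the first edge of `p` in its
  -- interior.
  chain-unique : Stab x → ∀ r S S' {p} → proj₁ p ∉ firsts S → proj₁ p ∉ firsts S' →
                 All (λ (a , c) → LegalF M x a c) S → All (λ (a , c) → LegalF M x a c) S' →
                 All (λ (r , r') → EssentialW M x (proj₂ r) (proj₁ r')) (zip (r ∷ S) (S ++ [ p ])) →
                 All (λ (r , r') → EssentialW M x (proj₂ r) (proj₁ r')) (zip (r ∷ S') (S' ++ [ p ])) →
                 S ≡ S'
  chain-unique st r []      []         _  _   _        _         _        _         = refl
  chain-unique st r []      (s' ∷ S') _  p∉' _        _         (w ∷ _) (w' ∷ _) =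
    contradiction (here (EssentialW-functional st w w')) p∉'
  chain-unique st r (s ∷ S) []         p∉ _   _        _         (w ∷ _) (w' ∷ _) =
    contradiction (here (EssentialW-functional st w' w)) p∉
  chain-unique {x} st r ((a , c) ∷ S) ((a' , c') ∷ S') p∉ p∉' (f ∷ fs) (f' ∷ fs') (w ∷ ws) (w' ∷ ws')
    with EssentialW-functional st w w'
  ... | refl with LegalF-functional x f f'
  ... | refl = cong ((a , c) ∷_)
    (chain-unique st (a , c) S S' (p∉ ∘ there) (p∉' ∘ there) fs fs' ws ws')

  private
    first∉ : ∀ l₁ {p : Fin m × Fin m} l₂ → Unique (firsts (l₁ ++ p ∷ l₂)) → proj₁ p ∉ firsts (l₂ ++ l₁)
    first∉ l₁ {p} l₂ u with Unique-resp-↭ (setoid (Fin m)) (↭⇒↭ₛ (↭-map⁺ proj₁ (↭-++-comm l₁ (p ∷ l₂)))) u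
    ... | p∉ ∷ _ = All¬⇒¬Any p∉

  -- Both cycles are opened at `a`; its F-arc is the same in both, and `chain-unique` equates the
  -- rest.
  same-if-overlapping : ∀ {R R' a} → Stab x → Unique (flatten M R) → Unique (flatten M R') →
                        Legal x R → Legal x R' → a ∈ firsts R → a ∈ firsts R' → SameRotation M R R'
  same-if-overlapping {x} st u u' leg leg' a∈ a∈' with ∈-map⁻ proj₁ a∈ | ∈-map⁻ proj₁ a∈'
  ... | (a , c) , r∈ , refl | (_ , c') , r∈' , refl with ∈-∃++ r∈ | ∈-∃++ r∈'
  ... | l₁ , l₂ , refl | l₁' , l₂' , refl
    with rotation-induction (Legal x) legal-rotate l₁ ((a , c) ∷ l₂) leg
       | rotation-induction (Legal x) legal-rotate l₁' ((a , c') ∷ l₂') leg'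
  ... | leg₁ | leg₁' with legal⁻ ((a , c) ∷ l₂ ++ l₁) leg₁ | legal⁻ ((a , c') ∷ l₂' ++ l₁') leg₁'
  ... | f ∷ fs , ws | f' ∷ fs' , ws' with LegalF-functional x f f'
  ... | refl with ++-overlap l₂ l₁ l₂' l₁' (chain-unique st (a , c) (l₂ ++ l₁) (l₂' ++ l₁')
                    (first∉ l₁ l₂ (UniqueFlatten.unique-firsts _ u))
                    (first∉ l₁' l₂' (UniqueFlatten.unique-firsts _ u')) fs fs' ws ws')
  ... | o , inj₁ (refl , refl) = l₁ ++ (a , c) ∷ l₂' , o ,
    sym (++-assoc l₁ ((a , c) ∷ l₂') o) , ++-assoc o l₁ ((a , c) ∷ l₂')
  ... | o , inj₂ (refl , refl) = o , l₁' ++ (a , c) ∷ l₂ ,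
    ++-assoc o l₁' ((a , c) ∷ l₂) , sym (++-assoc l₁' ((a , c) ∷ l₂) o)

  arc-code : Arc → Fin (m * m + m * m)
  arc-code = join (m * m) (m * m) ∘ ⊎-map (uncurry combine) (uncurry combine)

  arc-code-injective : ∀ α β → arc-code α ≡ arc-code β → α ≡ β
  arc-code-injective α β eq = uncode α β
    (trans (sym (splitAt-join (m * m) (m * m) _)) (trans (cong (splitAt (m * m)) eq) (splitAt-join (m * m) (m * m) _)))
    where
    uncode : ∀ α β → ⊎-map (uncurry combine) (uncurry combine) α ≡
                     ⊎-map (uncurry combine) (uncurry combine) β → α ≡ β
    uncode (inj₁ (a , c)) (inj₁ (a' , c')) eq with combine-injective a c a' c' (inj₁-injective eq)
    ... | refl , refl = refl
    uncode (inj₂ (a , c)) (inj₂ (a' , c')) eq with combine-injective a c a' c' (inj₂-injective eq)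
    ... | refl , refl = refl

-- Non-excessive routes: no repetition, and the length bound

module Routes (M : Market) (gap : ∀ v → Gapless M v) (T : Route M) (ne : NonExcessive M T) where
  open Market M using (m; p; q; wEnd; fEnd)
  open Stability M
  open Rotations M
  open Route T

  st : ∀ i → Stab (xs i)
  st i = Stable⇒Stab (stab i)

  step-later : ∀ j → Later (xs (inject₁ j)) (xs (suc j))
  step-later j with feasible-later (st (inject₁ j)) (feas j) (wt j) ≤-refl
  ... | y , s , _ , l = subst (Later (xs (inject₁ j)))
    (shift-unique (xs (inject₁ j)) (wt j) (rot j) y (xs (suc j)) s (step j)) l

  later-chain : ∀ {n} (xs : Fin (suc n) → Vec ℕ m) → (∀ i → Stab (xs i)) →
                (∀ j → Later (xs (inject₁ j)) (xs (suc j))) →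
                ∀ i j → toℕ i ≤ toℕ j → Later (xs i) (xs j)
  later-chain xs st steps zero zero _ = later-refl (st zero)
  later-chain {suc n} xs st steps zero (suc j) _ = later-trans (st _) (st _) (st _) (steps zero)
    (later-chain (xs ∘ suc) (st ∘ suc) (steps ∘ suc) zero j z≤n)
  later-chain {suc n} xs st steps (suc i) (suc j) (s≤s le) =
    later-chain (xs ∘ suc) (st ∘ suc) (steps ∘ suc) i j le

  later : ∀ i j → toℕ i ≤ toℕ j → Later (xs i) (xs j)
  later = later-chain xs st step-later

  arc-convex : ∀ i j k → toℕ i ≤ toℕ j → toℕ j ≤ toℕ k →
               ∀ α → Present (xs i) α → Present (xs k) α → Present (xs j) α
  arc-convex i j k le le' = present-convex gap (st i) (st j) (st k) (later i j le) (later j k le')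

  -- Only the final shift is new, and its stability follows from applicability at y alone, by
  -- `turn`.
  extend-feasible : ∀ x y R n → Stab y → Feasible M x R n → Shift M x n R y → Applicable M y R →
                    Feasible M x R (suc n)
  extend-feasible x y R n sy (_ , stables , apps) s ap = s≤s z≤n , stables⁺ , apps⁺
    where
    stables⁺ : ∀ i → i ≤ suc n → ∃[ z ] (Shift M x i R z × Stable M z)
    stables⁺ i le with m≤n⇒m<n∨m≡n le
    ... | inj₁ lt = stables i (s≤s⁻¹ lt)
    ... | inj₂ refl with turn sy ap
    ...   | z , s₁ , sz , _ = z , shift-suc x y z n R s s₁ , Stab⇒Stable sz
    apps⁺ : ∀ i → i < suc n → ∃[ z ] (Shift M x i R z × Applicable M z R)
    apps⁺ i le with m≤n⇒m<n∨m≡n (s≤s⁻¹ le)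
    ... | inj₁ lt   = apps i lt
    ... | inj₂ refl = y , s , ap

  no-repeat : ∀ j j' → toℕ j < toℕ j' → ¬ SameRotation M (rot j) (rot j')
  no-repeat j j' lt same = 1+n≰n (proj₂ (ne j j' lt same) (suc (wt j))
    (extend-feasible (xs (inject₁ j)) (xs (suc j)) (rot j) (wt j) (st (suc j)) (feas j) (step j)
      (legal⇒applicable (xs (inject₁ j)) (rot j) (appl j) legal-after)))
    where
    legal-after : Legal (xs (suc j)) (rot j)
    -- Each arc is present before step `j` and again before step `j'`; since `j` is less than `j'`,
    -- the member reached by step `j` lies between these two.
    legal-after = All-zipWith (λ {α} (before , again) → arc-convex (inject₁ j) (suc j) (inject₁ j')
        (≤-trans (≤-reflexive (toℕ-inject₁ j)) (n≤1+n _))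
        (≤-trans lt (≤-reflexive (sym (toℕ-inject₁ j')))) α before again)
      (applicable⇒legal (appl j) , legal-same same (applicable⇒legal (appl j')))

  rotations-distinct : ∀ j j' → SameRotation M (rot j) (rot j') → j ≡ j'
  rotations-distinct j j' same with <-cmp (toℕ j) (toℕ j')
  ... | tri< lt _ _ = contradiction same (no-repeat j j' lt)
  ... | tri≈ _ eq _ = toℕ-injective eq
  ... | tri> _ _ gt = contradiction (same-sym same) (no-repeat j' j gt)

  -- `time` may precede the step that uses R, hence only legality is recorded. As `new` concerns all
  -- earlier members, `time` is the first presence of `arc` and depends on the arc alone.
  record NewArc (R : Rotation M) : Set where
    field
      time   : Fin (suc n)
      legal  : Legal (xs time) R
      arc    : Arc
      arc∈   : arc ∈ arcs R
      new    : ∀ s → toℕ s < toℕ time → ¬ Present (xs s) arc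
  open NewArc

  new-arc : ∀ j → NewArc (rot j)
  new-arc j with first-time (λ i → All-all? (present? (st i)) (arcs (rot j)))
                            (inject₁ j , applicable⇒legal (appl j))
  ... | t , leg , inj₁ refl = record
    -- Nothing precedes the initial member, so any arc of the nonempty rotation serves.
    { time = zero ; legal = leg ; arc = proj₁ some-arc ; arc∈ = proj₂ some-arc ; new = λ _ () }
    where
    some : ∀ R → R ≢ [] → ∃[ α ] α ∈ arcs R
    some []      ne = contradiction refl ne
    some (r ∷ R) _  = inj₁ r , here refl
    some-arc = some (rot j) (proj₁ (appl j))
  ... | t , leg , inj₂ (s , refl , ¬leg)
    with find (¬All⇒Any¬ (present? (st (inject₁ s))) (arcs (rot j)) ¬leg)
  ... | α , α∈ , absent = record
    { time = suc s ; legal = leg ; arc = α ; arc∈ = α∈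
    -- An arc present at an earlier `s'` and at `suc s` would by convexity be present at `s`, where
    -- it is absent.
    ; new = λ s' lt pr → absent (arc-convex s' (inject₁ s) (suc s)
        (≤-trans (s≤s⁻¹ lt) (≤-reflexive (sym (toℕ-inject₁ s))))
        (≤-trans (≤-reflexive (toℕ-inject₁ s)) (n≤1+n _)) α pr (All-lookup leg α∈)) }

  same-time : ∀ {R R'} (ν : NewArc R) (ν' : NewArc R') → arc ν ≡ arc ν' → time ν ≡ time ν'
  same-time ν ν' eq with <-cmp (toℕ (time ν)) (toℕ (time ν'))
  ... | tri< lt _ _ = contradiction
    (subst (Present _) eq (All-lookup (legal ν) (arc∈ ν))) (new ν' (time ν) lt)
  ... | tri≈ _ t≡t' _ = toℕ-injective t≡t'
  ... | tri> _ _ gt = contradiction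
    (subst (Present _) (sym eq) (All-lookup (legal ν') (arc∈ ν'))) (new ν (time ν') gt)

  arc-determines-step : ∀ j j' → arc (new-arc j) ≡ arc (new-arc j') → j ≡ j'
  arc-determines-step j j' eq = rotations-distinct j j'
    (same-if-overlapping (st (time ν)) (proj₁ (proj₂ (appl j))) (proj₁ (proj₂ (appl j')))
      (legal ν) (subst (λ t → Legal (xs t) (rot j')) (sym (same-time ν ν' eq)) (legal ν'))
      (arc-end∈firsts (rot j) (arc∈ ν))
      (subst (λ α → arc-end α ∈ firsts (rot j')) (sym eq) (arc-end∈firsts (rot j') (arc∈ ν'))))
    where
    ν  = new-arc j
    ν' = new-arc j'

  steps-≤ : n ≤ m * m + m * m
  steps-≤ = injective⇒≤ {f = arc-code ∘ arc ∘ new-arc}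
    λ {j} {j'} eq → arc-determines-step j j' (arc-code-injective _ _ eq)

  route-length : 1 ≤ m → suc n < 4 * m * m * q * p
  route-length 1≤m = begin-strict
    suc n                              ≤⟨ s≤s steps-≤ ⟩
    -- Strict because 2|E|² is at least 2. One edge also makes both color classes nonempty, so their
    -- sizes can be multiplied in.
    suc (m * m + m * m)                <⟨ +-monoˡ-≤ (m * m + m * m) (+-mono-≤ 1≤m*m 1≤m*m) ⟩
    (m * m + m * m) + (m * m + m * m)  ≡⟨ four m ⟩
    4 * m * m                          ≤⟨ m≤m*n (4 * m * m) q {{nonZeroIndex (fEnd e)}} ⟩
    4 * m * m * q                      ≤⟨ m≤m*n (4 * m * m * q) p {{nonZeroIndex (wEnd e)}} ⟩
    4 * m * m * q * p                  ∎
    where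
    open ≤-Reasoning
    e : Fin m
    e = fromℕ< 1≤m
    1≤m*m : 1 ≤ m * m
    1≤m*m = *-mono-≤ 1≤m 1≤m
    four : ∀ m → (m * m + m * m) + (m * m + m * m) ≡ 4 * m * m
    four = solve-∀

theorem7p1 : (M : Market) → 1 ≤ Market.m M →
    (∀ v → Gapless M v) →
    (T : Route M) → NonExcessive M T →
    ((j j' : Fin (Route.n T)) →
    SameRotation M (Route.rot T j) (Route.rot T j') → j ≡ j')
    × (suc (Route.n T) < 4 * Market.m M * Market.m M * Market.q M * Market.p M)
theorem7p1 M 1≤m gap T ne = rotations-distinct , route-length 1≤m
  where open Routes M gap T ne
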